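{- Any cellular pseudomanifold is, uniquely (up to isomorphism), the join of an irreducible cellular pseudomanifold and a completely reducible cellular pseudomanifold.
   Context: A finite lattice $(X,<)$ is ranked if there is $\rho:X\to\mathbb N$ such that for each $x$ every maximal chain from $\mathbf 0$ to $x$ has length $\rho(x)$. For a ranked lattice $L$ with top $\mathbf 1$, $\Lambda(L)$ is the graph on the elements of rank $\rho(\mathbf 1)-1$, with $\sigma\ne\gamma$ adjacent iff $\rho(\sigma\wedge\gamma)=\rho(\mathbf 1)-2$. A cellular pseudomanifold is a finite ranked lattice $M$ such that for all $x<z$: if $\rho(z)=\rho(x)+2$ there are exactly two $y$ with $x<y<z$, and if $\rho(z)>\rho(x)+2$ then $\Lambda([x,z])$ is connected. Faces are its elements, $\dim f=\rho(f)-1$, $\dim M=\rho(\mathbf 1)-2$; vertices are faces of dimension $0$, facets faces of dimension $\dim M$. The shadow of a face is the set of vertices below it; faces are identified with shadows. $S^{\,k}_{k+2}$ ($k\ge-1$) is the lattice of all subsets of a $(k+2)$-set (a standard sphere). The join $M_1\ast M_2$ is the set of pairs $(\alpha,\beta)$ with both $\alpha,\beta<\mathbf 1$ or both $=\mathbf 1$, ordered by $(x_1,x_2)<(y_1,y_2)$ iff ($x_1\le y_1$ and $x_2<y_2$) or ($x_1<y_1$ and $x_2\le y_2$). For vertices $x,y$ of $M$, $x\sim y$ iff $x=y$ or the transposition of $x$ and $y$ induces an automorphism of $M$. $M$ is reducible if some $\sim$-equivalence class is not contained in the shadow of any facet, irreducible otherwise. $M$ is completely reducible if it is the join of finitely many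 standard spheres.
   Formalization: The one-element lattice (where 0 = 1, dimension −2) is excluded: its join with any cellular pseudomanifold is again the one-element lattice, so uniqueness of the completely reducible factor fails there. -}

module Defs where

open import Data.Nat using (ℕ; zero; suc)
open import Data.Fin using (Fin)
open import Data.Bool using (Bool; true; false; _∧_; not; T)
open import Data.Vec using (Vec; []; _∷_)
open import Data.Fin.Subset using (Subset; _⊂_)
open import Data.Product using (Σ; ∃; _×_; _,_)
open import Data.Sum using (_⊎_)
open import Data.List using (List; []; _∷_)
open import Relation.Nullary using (¬_)
open import Relation.Binary.PropositionalEquality using (_≡_; _≢_)
open import Relation.Binary.Definitions using (Decidable)
open import Relation.Binary.Construct.Closure.ReflexiveTransitive using (Star)
open import Function.Bundles using (_↔_; _⇔_; Inverse)

-- A finite bounded poset / lattice M is represented by its set of faces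
-- (= the elements different from the top 𝟏) together with the strict
-- order on them; the top 𝟏 is added formally (see Elt).  Every finite
-- lattice arises this way (up to isomorphism), and this makes the join
-- construction (pairs of proper elements plus (𝟏,𝟏)) literal.

record FacePoset : Set₁ where
  field
    Face : Set
    _≺_  : Face → Face → Set

open FacePoset public

data Elt (M : FacePoset) : Set where
  face : Face M → Elt M
  𝟏    : Elt M

module Order (M : FacePoset) where

  infix 4 _<_ _≤_

  _<_ : Elt M → Elt M → Set
  face x < face y = _≺_ M x y
  face x < 𝟏      = Data.Unit.⊤
    where import Data.Unit
  𝟏      < _      = Data.Empty.⊥
    where import Data.Empty

  _≤_ : Elt M → Elt M → Set
  x ≤ y = x ≡ y ⊎ x < y

  IsStrictPartialOrder : Set
  IsStrictPartialOrder =
    (∀ x → ¬ (x < x)) × (∀ x y z → x < y → y < z → x < z)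

  IsFinite : Set
  IsFinite = (Σ ℕ λ n → Face M ↔ Fin n) × Decidable (_≺_ M)

  IsMeet : Elt M → Elt M → Elt M → Set
  IsMeet x y m = m ≤ x × m ≤ y × (∀ z → z ≤ x → z ≤ y → z ≤ m)

  IsJoin : Elt M → Elt M → Elt M → Set
  IsJoin x y j = x ≤ j × y ≤ j × (∀ z → x ≤ z → y ≤ z → j ≤ z)

  IsLattice : Set
  IsLattice = (∀ x y → ∃ λ m → IsMeet x y m) × (∀ x y → ∃ λ j → IsJoin x y j)

  IsBottom : Elt M → Set
  IsBottom b = ∀ x → b ≤ x

  Covers : Elt M → Elt M → Set
  Covers x y = x < y × (∀ z → x < z → ¬ (z < y))

  data Chain : Elt M → Elt M → ℕ → Set where
    done : ∀ {x} → Chain x x zero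
    step : ∀ {x y z k} → Covers x y → Chain y z k → Chain x z (suc k)

  IsRankFunction : (Elt M → ℕ) → Set
  IsRankFunction ρ = ∀ b → IsBottom b → ∀ x k → Chain b x k → ρ x ≡ k

  Diamond : (Elt M → ℕ) → Set
  Diamond ρ = ∀ x z → x < z → ρ z ≡ suc (suc (ρ x)) →
    Σ (Elt M) λ y₁ → Σ (Elt M) λ y₂ →
      y₁ ≢ y₂ × (x < y₁ × y₁ < z) × (x < y₂ × y₂ < z) ×
      (∀ y → x < y → y < z → y ≡ y₁ ⊎ y ≡ y₂)

  -- the graph Λ([x,z]) (ranks inside [x,z] are ρ - ρ x, so we use ρ)
  ΛVertex : (Elt M → ℕ) → Elt M → Elt M → Elt M → Set
  ΛVertex ρ x z y = x ≤ y × y ≤ z × suc (ρ y) ≡ ρ z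

  ΛEdge : (Elt M → ℕ) → Elt M → Elt M → Elt M → Elt M → Set
  ΛEdge ρ x z σ γ = ΛVertex ρ x z σ × ΛVertex ρ x z γ × σ ≢ γ ×
    (∃ λ m → IsMeet σ γ m × suc (suc (ρ m)) ≡ ρ z)

  ΛConnected : (Elt M → ℕ) → Elt M → Elt M → Set
  ΛConnected ρ x z = ∀ σ γ → ΛVertex ρ x z σ → ΛVertex ρ x z γ →
    Star (ΛEdge ρ x z) σ γ

  Connectivity : (Elt M → ℕ) → Set
  Connectivity ρ = ∀ x z → x < z → suc (suc (suc (ρ x))) Data.Nat.≤ ρ z →
    ΛConnected ρ x z
    where import Data.Nat

  -- vertices: faces of dimension 0 (rank 1, i.e. covering 𝟎)
  IsVertex : Face M → Set
  IsVertex v = ∃ λ b → IsBottom b × Covers b (face v)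

  -- facets: faces of dimension dim M (rank ρ(𝟏) - 1, i.e. covered by 𝟏)
  IsFacet : Face M → Set
  IsFacet f = Covers (face f) 𝟏

open Order public

IsCellularPseudomanifold : FacePoset → Set
IsCellularPseudomanifold M =
  IsFinite M × IsStrictPartialOrder M × IsLattice M ×
  (Σ (Elt M → ℕ) λ ρ → IsRankFunction M ρ × Diamond M ρ × Connectivity M ρ)

-- M is not the one-element lattice (𝟎 ≠ 𝟏), i.e. it has at least one face
NonTrivial : FacePoset → Set
NonTrivial M = Face M

IsIsomorphism : (M N : FacePoset) → Elt M ↔ Elt N → Set
IsIsomorphism M N φ = ∀ x y → _<_ M x y ⇔ _<_ N (Inverse.to φ x) (Inverse.to φ y)

infix 4 _≅_
_≅_ : FacePoset → FacePoset → Set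
M ≅ N = Σ (Elt M ↔ Elt N) (IsIsomorphism M N)

infixr 6 _*_
_*_ : FacePoset → FacePoset → FacePoset
M₁ * M₂ = record
  { Face = Face M₁ × Face M₂
  ; _≺_  = λ { (x₁ , x₂) (y₁ , y₂) →
       (_≤_ M₁ (face x₁) (face y₁) × _≺_ M₂ x₂ y₂)
     ⊎ (_≺_ M₁ x₁ y₁ × _≤_ M₂ (face x₂) (face y₂)) }
  }

-- standard spheres: Sphere m = S^{m-1}_{m+1}, the lattice of all subsets
-- of Fin (suc m); its faces are the proper subsets, 𝟏 is the full set.

full? : ∀ {n} → Subset n → Bool
full? [] = true
full? (b ∷ s) = b ∧ full? s

Sphere : ℕ → FacePoset
Sphere m = record
  { Face = Σ (Subset (suc m)) (λ s → T (not (full? s)))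
  ; _≺_  = λ { (s , _) (t , _) → s ⊂ t }
  }

joinSpheres : ℕ → List ℕ → FacePoset
joinSpheres m []        = Sphere m
joinSpheres m (m' ∷ ms) = Sphere m * joinSpheres m' ms

CompletelyReducible : FacePoset → Set
CompletelyReducible M = Σ ℕ λ m → Σ (List ℕ) λ ms → M ≅ joinSpheres m ms

TranspositionAut : (M : FacePoset) → Face M → Face M → Set
TranspositionAut M x y = Σ (Elt M ↔ Elt M) λ φ → IsIsomorphism M M φ ×
  Inverse.to φ (face x) ≡ face y × Inverse.to φ (face y) ≡ face x ×
  (∀ v → IsVertex M v → v ≢ x → v ≢ y → Inverse.to φ (face v) ≡ face v)

Equiv : (M : FacePoset) → Face M → Face M → Set
Equiv M x y = x ≡ y ⊎ TranspositionAut M x y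

Reducible : FacePoset → Set
Reducible M = Σ (Face M) λ x → IsVertex M x ×
  (∀ f → IsFacet M f →
     ¬ (∀ y → IsVertex M y → Equiv M x y → _≤_ M (face y) (face f)))

Irreducible : FacePoset → Set
Irreducible M = ¬ Reducible M

{-# OPTIONS --safe #-}
module Submission where

-- Existence.  Let E be a ∼-class lying in no facet.  The diamond condition shows that a
-- facet meeting E omits exactly one vertex of E (otherwise some f ∖ c lies in three facets),
-- and connectivity of Λ shows that every facet meets E.  As every face is the meet of
-- the facets above it, (α ∖ E) ∪ B is then a face for every face α and every B ⊊ E, so M is the join of its faces disjoint from E with the standard sphere on E.
-- Iterate, and note that the factors of a join are upper intervals of it, hence again
-- cellular pseudomanifolds.
--
-- Uniqueness.  In a join no class lying in no facet meets both factors, since a facet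
-- could then omit two of its vertices.  Hence in I * C the vertices of C are exactly
-- those whose class lies in no facet, and an isomorphism of joins restricts to the factors.

open import Defs
open import Data.Product using (Σ; _×_)
open import Data.Bool using (true; T; not)
open import Data.Bool.Properties using (T-irrelevant)
open import Data.Empty using (⊥; ⊥-elim)
open import Data.Fin using (Fin; zero; suc; finToFun; funToFin)
open import Data.Fin.Induction using (spo-wellFounded)
open import Data.Fin.Properties using (any?; all?; suc-injective; finToFun-funToFin; injective⇒≤) renaming (_≟_ to _≟F_)
open import Data.Fin.Subset as Subset using (Subset; inside; outside; _∈_; _∉_; _⊆_; _⊂_; ⁅_⁆)
open import Data.Fin.Subset.Properties using (_∈?_; ⊆-antisym; x∈⁅x⁆; x∈⁅y⁆⇒x≡y; ∉⊥; drop-there)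
open import Data.List using ([]; _∷_)
open import Data.Nat as ℕ using (ℕ; zero; suc; _+_)
open import Data.Nat.Induction using (<-wellFounded)
import Data.Nat.Properties as ℕₚ
open import Data.Product using (∃; _,_; proj₁; proj₂)
open import Data.Sum using (_⊎_; inj₁; inj₂)
open import Data.Unit using (tt)
open import Data.Vec using ([]; _∷_; tabulate; lookup; here; there)
open import Data.Vec.Properties using ([]=⇒lookup; lookup⇒[]=; lookup∘tabulate)
open import Function.Base using (_∘_; id; flip; _on_)
open import Function.Bundles using (_↔_; Inverse; Equivalence; mk⇔; mk↔ₛ′)
open import Induction.WellFounded using (WellFounded; Acc; acc)
open import Relation.Binary.Construct.Closure.ReflexiveTransitive using (Star; ε; _◅_)
open import Relation.Binary.Construct.On using (wellFounded)
open import Relation.Binary.Definitions using (DecidableEquality)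
open import Relation.Binary.PropositionalEquality using (_≡_; _≢_; refl; sym; trans; cong; cong₂; subst; subst₂; isEquivalence)
open import Relation.Nullary using (¬_; Dec; yes; no)
open import Relation.Nullary.Decidable using (map′; _×-dec_; _→-dec_; _⊎-dec_; ¬?; decidable-stable; does; dec-true)
open import Relation.Unary using (Decidable)

-- `Irreducible` is a negation, so the iteration has to decide reducibility. The only
-- unbounded-looking ingredient is the existence of an automorphism inducing a transposition; it is
-- settled by a finite search through pairs of maps on faces. The iteration stops because the factor
-- that remains after a splitting has fewer faces: the members of the class are no longer among
-- them. A completely reducible factor is a join of at least one sphere. For an irreducible M this
-- place is taken by `Sphere 0`, whose only face is the empty set and which is neutral for `_*_`.
-- The pseudomanifold axioms travel only downwards, from a join to its factors; the standard spheres
-- that are split off acquire them in the same way. An isomorphism of joins restricts to the factors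
-- because a face is determined by its vertices: a face (x, 𝟎) has only vertices of the first factor
-- below it, and its image then has no vertex of the second.

-- Finite search and enumeration

Finite : Set → Set
Finite A = Σ ℕ λ n → A ↔ Fin n

module Search {A : Set} (finite : Finite A) where

  index : A → Fin (proj₁ finite)
  index = Inverse.to (proj₂ finite)

  element : Fin (proj₁ finite) → A
  element = Inverse.from (proj₂ finite)

  element-index : ∀ a → element (index a) ≡ a
  element-index = Inverse.strictlyInverseʳ (proj₂ finite)

  index-element : ∀ i → index (element i) ≡ i
  index-element = Inverse.strictlyInverseˡ (proj₂ finite)

  index-injective : ∀ {a b} → index a ≡ index b → a ≡ b
  index-injective {a} {b} p = trans (sym (element-index a)) (trans (cong element p) (element-index b))

  infix 4 _≟_
  _≟_ : DecidableEquality A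
  a ≟ b = map′ index-injective (cong index) (index a ≟F index b)

  exists? : {P : A → Set} → Decidable P → Dec (∃ P)
  exists? {P} P? = map′ (λ (i , p) → element i , p)
    (λ (a , p) → index a , subst P (sym (element-index a)) p) (any? (P? ∘ element))

  forall? : {P : A → Set} → Decidable P → Dec (∀ a → P a)
  forall? {P} P? = map′ (λ h a → subst P (element-index a) (h (index a)))
    (λ h i → h (element i)) (all? (P? ∘ element))

  -- The search visits only maps decoded from finite codes, and a given map agrees with its decoded
  -- form only pointwise; hence `P` has to respect pointwise equality.
  exists-fun? : {P : (A → A) → Set} → (∀ {f g} → (∀ a → f a ≡ g a) → P f → P g) →
    Decidable P → Dec (∃ P)
  exists-fun? {P} resp P? = map′ (λ (i , p) → decode i , p)
    (λ (f , p) → funToFin (index ∘ f ∘ element) , resp (λ a → sym (decode-code f a)) p)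
    (any? (P? ∘ decode))
    where
    decode : Fin _ → A → A
    decode i = element ∘ finToFun i ∘ index
    decode-code : ∀ f a → decode (funToFin (index ∘ f ∘ element)) a ≡ f a
    decode-code f a = trans (cong element (finToFun-funToFin (index ∘ f ∘ element) (index a)))
      (trans (element-index _) (cong f (element-index a)))

  wf : {_⊏_ : A → A → Set} → (∀ a → ¬ (a ⊏ a)) → (∀ {a b c} → a ⊏ b → b ⊏ c → a ⊏ c) →
    WellFounded _⊏_
  wf {_⊏_} irr tr a = go (wellFounded index on-fin a)
    where
    on-fin : WellFounded (_⊏_ on element)
    on-fin = spo-wellFounded (record
      { isEquivalence = isEquivalence
      ; irrefl = λ { refl → irr _ }
      ; trans = tr
      ; <-resp-≈ = (λ { refl → id }) , (λ { refl → id }) })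
    go : ∀ {a} → Acc ((_⊏_ on element) on index) a → Acc _⊏_ a
    go (acc rs) = acc λ {b} b⊏a → go (rs (subst₂ _⊏_ (sym (element-index b)) (sym (element-index _)) b⊏a))

-- A decidable subset indexed by `Fin size`, standing in for `Σ A P`: two members are equal as soon
-- as they are equal in `A`, whatever the proofs of `P`.
record Enumeration {A : Set} (P : A → Set) : Set where
  field
    size      : ℕ
    at        : Fin size → A
    injective : ∀ {i j} → at i ≡ at j → i ≡ j
    sound     : ∀ i → P (at i)
    position  : ∀ a → P a → Fin size
    at-position : ∀ a p → at (position a p) ≡ a

enumerateFin : ∀ n {P : Fin n → Set} → Decidable P → Enumeration P
enumerateFin zero P? = record
  { size = 0 ; at = λ () ; injective = λ { {()} } ; sound = λ () ; position = λ () ; at-position = λ () }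
enumerateFin (suc n) {P} P? with enumerateFin n (P? ∘ suc) | P? zero
... | E | no ¬p0 = record
  { size = size ; at = suc ∘ at ; injective = injective ∘ suc-injective ; sound = sound
  ; position = λ { zero p → ⊥-elim (¬p0 p) ; (suc i) p → position i p }
  ; at-position = λ { zero p → ⊥-elim (¬p0 p) ; (suc i) p → cong suc (at-position i p) } }
  where open Enumeration E
... | E | yes p0 = record
  { size = suc size
  ; at = at′
  ; injective = inj
  ; sound = λ { zero → p0 ; (suc i) → sound i }
  ; position = λ { zero _ → zero ; (suc i) p → suc (position i p) }
  ; at-position = λ { zero _ → refl ; (suc i) p → cong suc (at-position i p) } }
  where
  open Enumeration E
  at′ : Fin (suc size) → Fin (suc n)
  at′ zero = zero
  at′ (suc i) = suc (at i)
  inj : ∀ {i j} → at′ i ≡ at′ j → i ≡ j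
  inj {zero} {zero} _ = refl
  inj {suc i} {suc j} p = cong suc (injective (suc-injective p))

enumerate : ∀ {A} → Finite A → {P : A → Set} → Decidable P → Enumeration P
enumerate finite {P} P? = record
  { size = size
  ; at = element ∘ at
  ; injective = λ p → injective (trans (sym (index-element _)) (trans (cong index p) (index-element _)))
  ; sound = sound
  ; position = λ a p → position (index a) (subst P (sym (element-index a)) p)
  ; at-position = λ a p → trans (cong element (at-position _ _)) (element-index a) }
  where
  open Search finite
  open Enumeration (enumerateFin (proj₁ finite) (P? ∘ element))

-- Isomorphisms on the level of faces

face-injective : ∀ {M x y} → face {M} x ≡ face y → x ≡ y
face-injective refl = refl

Lt Le : (M : FacePoset) → Face M → Face M → Set
Lt M x y = _≺_ M x y
Le M x y = _≤_ M (face x) (face y)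

infix 4 Lt Le
syntax Lt M x y = x ≺[ M ] y
syntax Le M x y = x ≼[ M ] y

Bottom : (M : FacePoset) → Face M → Set
Bottom M b = ∀ x → b ≼[ M ] x

vertex-intro : ∀ M {b v} → Bottom M b → b ≺[ M ] v → (∀ z → b ≺[ M ] z → ¬ (z ≺[ M ] v)) → IsVertex M v
vertex-intro M {b} bot b<v cov = face b , (λ { (face x) → bot x ; 𝟏 → inj₂ tt }) , b<v , λ { (face z) → cov z ; 𝟏 _ () }

vertex-elim : ∀ M {v} → IsVertex M v →
  Σ (Face M) λ b → Bottom M b × b ≺[ M ] v × (∀ z → b ≺[ M ] z → ¬ (z ≺[ M ] v))
vertex-elim M (face b , bot , b<v , cov) = b , (λ x → bot (face x)) , b<v , λ z → cov (face z)

facet-intro : ∀ M {f} → (∀ g → ¬ (f ≺[ M ] g)) → IsFacet M f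
facet-intro M max = tt , λ { (face g) f<g _ → max g f<g ; 𝟏 _ () }

facet-elim : ∀ M {f} → IsFacet M f → ∀ g → ¬ (f ≺[ M ] g)
facet-elim M (_ , max) g f<g = max (face g) f<g tt

infix 4 _≃_
-- An isomorphism of lattices has to fix `𝟏`, so it amounts to one between the posets of faces. The
-- conversions `≃⇒≅` and `≅⇒≃` confine `Elt` to the boundary of the proof.
record _≃_ (M N : FacePoset) : Set where
  field
    to      : Face M → Face N
    from    : Face N → Face M
    to-from : ∀ y → to (from y) ≡ y
    from-to : ∀ x → from (to x) ≡ x
    to-≺    : ∀ {x y} → x ≺[ M ] y → to x ≺[ N ] to y
    from-≺  : ∀ {x y} → x ≺[ N ] y → from x ≺[ M ] from y

  to-≼ : ∀ {x y} → x ≼[ M ] y → to x ≼[ N ] to y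
  to-≼ (inj₁ p) = inj₁ (cong (face ∘ to) (face-injective p))
  to-≼ (inj₂ p) = inj₂ (to-≺ p)

  from-≼ : ∀ {x y} → x ≼[ N ] y → from x ≼[ M ] from y
  from-≼ (inj₁ p) = inj₁ (cong (face ∘ from) (face-injective p))
  from-≼ (inj₂ p) = inj₂ (from-≺ p)

  to-≺⁻¹ : ∀ {x y} → to x ≺[ N ] to y → x ≺[ M ] y
  to-≺⁻¹ p = subst₂ (_≺_ M) (from-to _) (from-to _) (from-≺ p)

  to-≼⁻¹ : ∀ {x y} → to x ≼[ N ] to y → x ≼[ M ] y
  to-≼⁻¹ p = subst₂ (Le M) (from-to _) (from-to _) (from-≼ p)

  to-injective : ∀ {x y} → to x ≡ to y → x ≡ y
  to-injective p = trans (sym (from-to _)) (trans (cong from p) (from-to _))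

≃-refl : ∀ {M} → M ≃ M
≃-refl = record { to = id ; from = id ; to-from = λ _ → refl ; from-to = λ _ → refl ; to-≺ = id ; from-≺ = id }

≃-sym : ∀ {M N} → M ≃ N → N ≃ M
≃-sym φ = record { to = from ; from = to ; to-from = from-to ; from-to = to-from ; to-≺ = from-≺ ; from-≺ = to-≺ }
  where open _≃_ φ

≃-trans : ∀ {M N K} → M ≃ N → N ≃ K → M ≃ K
≃-trans φ ψ = record
  { to = ψ.to ∘ φ.to ; from = φ.from ∘ ψ.from
  ; to-from = λ y → trans (cong ψ.to (φ.to-from _)) (ψ.to-from y)
  ; from-to = λ x → trans (cong φ.from (ψ.from-to _)) (φ.from-to x)
  ; to-≺ = ψ.to-≺ ∘ φ.to-≺ ; from-≺ = φ.from-≺ ∘ ψ.from-≺ }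
  where
  module φ = _≃_ φ
  module ψ = _≃_ ψ

≃⇒≅ : ∀ {M N} → M ≃ N → M ≅ N
≃⇒≅ {M} {N} φ = mk↔ₛ′ to′ from′ (λ { (face x) → cong face (to-from x) ; 𝟏 → refl }) (λ { (face x) → cong face (from-to x) ; 𝟏 → refl }) ,
  λ { (face x) (face y) → mk⇔ to-≺ to-≺⁻¹ ; (face x) 𝟏 → mk⇔ id id ; 𝟏 y → mk⇔ (λ ()) (λ ()) }
  where
  open _≃_ φ
  to′ : Elt M → Elt N
  to′ (face x) = face (to x)
  to′ 𝟏 = 𝟏
  from′ : Elt N → Elt M
  from′ (face x) = face (from x)
  from′ 𝟏 = 𝟏

≅-sym : ∀ {M N} → M ≅ N → N ≅ M
≅-sym {M} {N} (φ , iso) = mk↔ₛ′ φ.from φ.to φ.strictlyInverseʳ φ.strictlyInverseˡ ,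
  λ x y → mk⇔
    (λ p → Equivalence.from (iso _ _) (subst₂ (_<_ N) (sym (φ.strictlyInverseˡ x)) (sym (φ.strictlyInverseˡ y)) p))
    (λ p → subst₂ (_<_ N) (φ.strictlyInverseˡ x) (φ.strictlyInverseˡ y) (Equivalence.to (iso _ _) p))
  where module φ = Inverse φ

-- A face lies below `𝟏`, so its image lies strictly below something, which `𝟏` does not.
≅-face : ∀ {M N} (φ : M ≅ N) x → Σ (Face N) λ y → Inverse.to (proj₁ φ) (face x) ≡ face y
≅-face {M} {N} (φ , iso) x with Inverse.to φ (face x) | Equivalence.to (iso (face x) 𝟏) tt
... | face y | _ = y , refl

≅⇒≃ : ∀ {M N} → M ≅ N → M ≃ N
≅⇒≃ {M} {N} φ = record
  { to = λ x → proj₁ (≅-face φ x)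
  ; from = λ y → proj₁ (≅-face φ⁻¹ y)
  ; to-from = λ y → face-injective (trans (sym (proj₂ (≅-face φ _)))
      (trans (cong (Inverse.to (proj₁ φ)) (sym (proj₂ (≅-face φ⁻¹ y)))) (Inverse.strictlyInverseˡ (proj₁ φ) (face y))))
  ; from-to = λ x → face-injective (trans (sym (proj₂ (≅-face φ⁻¹ _)))
      (trans (cong (Inverse.from (proj₁ φ)) (sym (proj₂ (≅-face φ x)))) (Inverse.strictlyInverseʳ (proj₁ φ) (face x))))
  ; to-≺ = λ {x} {y} p → subst₂ (_<_ N) (proj₂ (≅-face φ x)) (proj₂ (≅-face φ y)) (Equivalence.to (proj₂ φ (face x) (face y)) p)
  ; from-≺ = λ {x} {y} p → subst₂ (_<_ M) (proj₂ (≅-face φ⁻¹ x)) (proj₂ (≅-face φ⁻¹ y)) (Equivalence.to (proj₂ φ⁻¹ (face x) (face y)) p) }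
  where φ⁻¹ = ≅-sym {M} {N} φ

≃-bottom : ∀ {M N} (φ : M ≃ N) {b} → Bottom M b → Bottom N (_≃_.to φ b)
≃-bottom {M} {N} φ bot x = subst (Le N _) (to-from x) (to-≼ (bot (from x)))
  where open _≃_ φ

≃-vertex : ∀ {M N} (φ : M ≃ N) {v} → IsVertex M v → IsVertex N (_≃_.to φ v)
≃-vertex {M} {N} φ vert with vertex-elim M vert
... | b , bot , b<v , cov = vertex-intro N (≃-bottom φ bot) (to-≺ b<v)
  λ z b<z z<v → cov (from z) (subst (λ u → u ≺[ M ] _) (from-to b) (from-≺ b<z)) (subst (Lt M _) (from-to _) (from-≺ z<v))
  where open _≃_ φ

≃-facet : ∀ {M N} (φ : M ≃ N) {f} → IsFacet M f → IsFacet N (_≃_.to φ f)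
≃-facet {M} {N} φ fac = facet-intro N λ g f<g → facet-elim M fac (from g) (subst (λ u → u ≺[ M ] _) (from-to _) (from-≺ f<g))
  where open _≃_ φ

-- The relation ∼ and its classes

-- A face-level form of TranspositionAut.
Swap : (M : FacePoset) → Face M → Face M → Set
Swap M x y = Σ (M ≃ M) λ φ → _≃_.to φ x ≡ y × _≃_.to φ y ≡ x ×
  (∀ v → IsVertex M v → v ≢ x → v ≢ y → _≃_.to φ v ≡ v)

Similar : (M : FacePoset) → Face M → Face M → Set
Similar M x y = x ≡ y ⊎ Swap M x y

Similar⇒Equiv : ∀ M {x y} → Similar M x y → Equiv M x y
Similar⇒Equiv M (inj₁ p) = inj₁ p
Similar⇒Equiv M (inj₂ (φ , p , q , fix)) = inj₂ (proj₁ φ′ , proj₂ φ′ , cong face p , cong face q ,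
  λ v vert v≢x v≢y → cong face (fix v vert v≢x v≢y))
  where φ′ = ≃⇒≅ {M} {M} φ

Equiv⇒Similar : ∀ M {x y} → Equiv M x y → Similar M x y
Equiv⇒Similar M (inj₁ p) = inj₁ p
Equiv⇒Similar M (inj₂ (φ , iso , p , q , fix)) = inj₂ (≅⇒≃ {M} {M} (φ , iso) , image p , image q ,
  λ v vert v≢x v≢y → image (fix v vert v≢x v≢y))
  where
  image : ∀ {x y} → Inverse.to φ (face x) ≡ face y → proj₁ (≅-face {M} {M} (φ , iso) x) ≡ y
  image {x} p = face-injective (trans (sym (proj₂ (≅-face {M} {M} (φ , iso) x))) p)

Similar-sym : ∀ M {x y} → Similar M x y → Similar M y x
Similar-sym M (inj₁ p) = inj₁ (sym p)
Similar-sym M (inj₂ (φ , p , q , fix)) = inj₂ (φ , q , p , λ v vert v≢y v≢x → fix v vert v≢x v≢y)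

-- (y z) = (x y)(x z)(x y)
Similar-trans : ∀ M → DecidableEquality (Face M) → ∀ {x y z} → IsVertex M x → IsVertex M y → IsVertex M z →
  Similar M y x → Similar M x z → Similar M y z
Similar-trans M _≟_ _ _ _ (inj₁ refl) s = s
Similar-trans M _≟_ _ _ _ s@(inj₂ _) (inj₁ refl) = s
Similar-trans M _≟_ {x} {y} {z} vx vy vz (inj₂ (φ , φy , φx , φfix)) (inj₂ (ψ , ψx , ψz , ψfix))
  with x ≟ y | x ≟ z | y ≟ z
... | yes refl | _ | _ = inj₂ (ψ , ψx , ψz , ψfix)
... | no _ | yes refl | _ = inj₂ (φ , φy , φx , φfix)
... | no _ | no _ | yes p = inj₁ p
... | no x≢y | no x≢z | no y≢z = inj₂ (≃-trans φ (≃-trans ψ φ) ,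
    trans (cong (φ.to ∘ ψ.to) φy) (trans (cong φ.to ψx) (φfix z vz (y≢z ∘ sym) (x≢z ∘ sym))) ,
    trans (cong (φ.to ∘ ψ.to) (φfix z vz (y≢z ∘ sym) (x≢z ∘ sym))) (trans (cong φ.to ψz) φx) ,
    λ v vv v≢y v≢z → fixes v vv v≢y v≢z (v ≟ x))
  where
  module φ = _≃_ φ
  module ψ = _≃_ ψ
  fixes : ∀ v → IsVertex M v → v ≢ y → v ≢ z → Dec (v ≡ x) → φ.to (ψ.to (φ.to v)) ≡ v
  fixes v vv v≢y v≢z (yes refl) =
    trans (cong (φ.to ∘ ψ.to) φx) (trans (cong φ.to (ψfix y vy v≢y∘sym y≢z)) φy)
    where v≢y∘sym = v≢y ∘ sym
  fixes v vv v≢y v≢z (no v≢x) =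
    trans (cong (φ.to ∘ ψ.to) (φfix v vv v≢y v≢x)) (trans (cong φ.to (ψfix v vv v≢x v≢z)) (φfix v vv v≢y v≢x))

≃-Similar : ∀ {M N} (φ : M ≃ N) {x y} → Similar M x y → Similar N (_≃_.to φ x) (_≃_.to φ y)
≃-Similar φ (inj₁ p) = inj₁ (cong (_≃_.to φ) p)
≃-Similar {M} {N} φ (inj₂ (σ , p , q , fix)) = inj₂ (≃-trans (≃-sym φ) (≃-trans σ φ) ,
  cong to (trans (cong σ.to (from-to _)) p) ,
  cong to (trans (cong σ.to (from-to _)) q) ,
  λ v vv v≢x v≢y → trans (cong to (fix (from v) (≃-vertex (≃-sym φ) vv)
    (λ e → v≢x (trans (sym (to-from v)) (cong to e)))
    (λ e → v≢y (trans (sym (to-from v)) (cong to e))))) (to-from v))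
  where
  open _≃_ φ
  module σ = _≃_ σ

-- The condition of `Reducible` at a single vertex: its class lies in no facet. This form can be
-- carried along isomorphisms and in and out of joins, vertex by vertex.
ReducibleAt : (M : FacePoset) → Face M → Set
ReducibleAt M x = ∀ f → IsFacet M f → ¬ (∀ y → IsVertex M y → Similar M x y → y ≼[ M ] f)

≃-ReducibleAt : ∀ {M N} (φ : M ≃ N) {x} → ReducibleAt M x → ReducibleAt N (_≃_.to φ x)
≃-ReducibleAt {M} {N} φ {x} red f fac h = red (from f) (≃-facet (≃-sym φ) fac)
  λ y vy s → subst (λ u → u ≼[ M ] from f) (from-to y) (from-≼ (h (to y) (≃-vertex φ vy) (≃-Similar φ s)))
  where open _≃_ φ

ReducibleAt⇒Reducible : ∀ M {x} → IsVertex M x → ReducibleAt M x → Reducible M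
ReducibleAt⇒Reducible M {x} vx red = x , vx , λ f fac h → red f fac λ y vy s → h y vy (Similar⇒Equiv M s)

Reducible⇒ReducibleAt : ∀ M → Reducible M → Σ (Face M) λ x → IsVertex M x × ReducibleAt M x
Reducible⇒ReducibleAt M (x , vx , red) = x , vx , λ f fac h → red f fac λ y vy s → h y vy (Equiv⇒Similar M s)

-- Order, rank, vertices and facets of a pseudomanifold

Elt-finite : ∀ {M} → Finite (Face M) → Finite (Elt M)
Elt-finite {M} finite = suc (proj₁ finite) , mk↔ₛ′ code decode
  (λ { zero → refl ; (suc i) → cong suc (index-element i) })
  (λ { (face x) → cong face (element-index x) ; 𝟏 → refl })
  where
  open Search finite
  code : Elt M → Fin (suc (proj₁ finite))
  code (face x) = suc (index x)
  code 𝟏 = zero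
  decode : Fin (suc (proj₁ finite)) → Elt M
  decode zero = 𝟏
  decode (suc i) = face (element i)

module Pseudomanifold (M : FacePoset) (cp : IsCellularPseudomanifold M) (x₀ : Face M) where

  open Order M using () renaming (_<_ to infix 4 _⊏_; _≤_ to infix 4 _⊑_)

  infix 4 _≼_
  _≼_ : Face M → Face M → Set
  x ≼ y = x ≼[ M ] y

  finite : Finite (Face M)
  finite = proj₁ (proj₁ cp)

  open Search finite public using (exists-fun?) renaming (_≟_ to _≟ᶠ_; exists? to exists-face?; forall? to forall-face?)
  open Search (Elt-finite {M} finite) public using () renaming (_≟_ to _≟ᵉ_; exists? to exists-elt?; forall? to forall-elt?; wf to wf-elt)

  ⊏-irrefl : ∀ x → ¬ (x ⊏ x)
  ⊏-irrefl = proj₁ (proj₁ (proj₂ cp))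

  ⊏-trans : ∀ x y z → x ⊏ y → y ⊏ z → x ⊏ z
  ⊏-trans = proj₂ (proj₁ (proj₂ cp))

  infix 4 _⊏?_ _⊑?_
  _⊏?_ : ∀ x y → Dec (x ⊏ y)
  face x ⊏? face y = proj₂ (proj₁ cp) x y
  face x ⊏? 𝟏 = yes tt
  𝟏 ⊏? y = no λ ()

  _⊑?_ : ∀ x y → Dec (x ⊑ y)
  x ⊑? y = (x ≟ᵉ y) ⊎-dec (x ⊏? y)

  _≼?_ : ∀ x y → Dec (x ≼ y)
  x ≼? y = face x ⊑? face y

  ⊑-refl : ∀ {x} → x ⊑ x
  ⊑-refl = inj₁ refl

  ⊏-⊑-trans : ∀ x {y z} → x ⊏ y → y ⊑ z → x ⊏ z
  ⊏-⊑-trans x p (inj₁ refl) = p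
  ⊏-⊑-trans x {y} {z} p (inj₂ q) = ⊏-trans x y z p q

  ⊑-⊏-trans : ∀ {x y} z → x ⊑ y → y ⊏ z → x ⊏ z
  ⊑-⊏-trans z (inj₁ refl) q = q
  ⊑-⊏-trans {x} {y} z (inj₂ p) q = ⊏-trans x y z p q

  ⊑-trans : ∀ {x y z} → x ⊑ y → y ⊑ z → x ⊑ z
  ⊑-trans (inj₁ refl) q = q
  ⊑-trans {x} (inj₂ p) q = inj₂ (⊏-⊑-trans x p q)

  ⊑-antisym : ∀ {x y} → x ⊑ y → y ⊑ x → x ≡ y
  ⊑-antisym (inj₁ p) _ = p
  ⊑-antisym {x} (inj₂ p) q = ⊥-elim (⊏-irrefl x (⊏-⊑-trans x p q))

  ≼-antisym : ∀ {x y} → x ≼ y → y ≼ x → x ≡ y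
  ≼-antisym p q = face-injective (⊑-antisym p q)

  ⊑∧≢⇒⊏ : ∀ {x y} → x ⊑ y → x ≢ y → x ⊏ y
  ⊑∧≢⇒⊏ (inj₁ p) ne = ⊥-elim (ne p)
  ⊑∧≢⇒⊏ (inj₂ p) _ = p

  ⊑𝟏 : ∀ x → x ⊑ 𝟏
  ⊑𝟏 (face x) = inj₂ tt
  ⊑𝟏 𝟏 = ⊑-refl

  ⊏-wf : WellFounded _⊏_
  ⊏-wf = wf-elt ⊏-irrefl (λ {x} {y} {z} → ⊏-trans x y z)

  ⊐-wf : WellFounded (flip _⊏_)
  ⊐-wf = wf-elt ⊏-irrefl (λ {x} {y} {z} p q → ⊏-trans z y x q p)

  between? : ∀ x y → Dec (∃ λ z → x ⊏ z × z ⊏ y)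
  between? x y = exists-elt? λ z → (x ⊏? z) ×-dec (z ⊏? y)

  cover-above : ∀ x y → x ⊏ y → ∃ λ c → Covers M x c × c ⊑ y
  cover-above x y = go (⊏-wf y)
    where
    go : ∀ {y} → Acc _⊏_ y → x ⊏ y → ∃ λ c → Covers M x c × c ⊑ y
    go {y} (acc rs) p with between? x y
    ... | no none = y , (p , λ z q r → none (z , q , r)) , ⊑-refl
    ... | yes (z , q , r) with go (rs r) q
    ... | c , cov , c⊑z = c , cov , inj₂ (⊑-⊏-trans y c⊑z r)

  cover-below : ∀ x y → x ⊏ y → ∃ λ c → x ⊑ c × Covers M c y
  cover-below x y = go (⊐-wf x)
    where
    go : ∀ {x} → Acc (flip _⊏_) x → x ⊏ y → ∃ λ c → x ⊑ c × Covers M c y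
    go {x} (acc rs) p with between? x y
    ... | no none = x , ⊑-refl , (p , λ z q r → none (z , q , r))
    ... | yes (z , q , r) with go (rs q) r
    ... | c , z⊑c , cov = c , inj₂ (⊏-⊑-trans x q z⊑c) , cov

  chain : ∀ {x y} → x ⊑ y → ∃ λ k → Chain M x y k
  chain {x} {y} = go (⊐-wf x)
    where
    go : ∀ {x} → Acc (flip _⊏_) x → x ⊑ y → ∃ λ k → Chain M x y k
    go _ (inj₁ refl) = 0 , done
    go {x} (acc rs) (inj₂ p) with cover-above x y p
    ... | c , cov , c⊑y with go (rs (proj₁ cov)) c⊑y
    ... | k , ch = suc k , step cov ch

  chain-++ : ∀ {x y z k l} → Chain M x y k → Chain M y z l → Chain M x z (k + l)
  chain-++ done d = d
  chain-++ (step cov c) d = step cov (chain-++ c d)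

  meet : ∀ x y → ∃ λ m → IsMeet M x y m
  meet = proj₁ (proj₁ (proj₂ (proj₂ cp)))

  join : ∀ x y → ∃ λ j → IsJoin M x y j
  join = proj₂ (proj₁ (proj₂ (proj₂ cp)))

  abstract
    -- The descent starts at `x₀`: in the one-element lattice the bottom would be `𝟏` and not a
    -- face.
    minimal-face : ∃ λ b → ∀ y → ¬ (y ⊏ face b)
    minimal-face = go (⊏-wf (face x₀))
      where
      go : ∀ {x} → Acc _⊏_ (face x) → ∃ λ b → ∀ y → ¬ (y ⊏ face b)
      go {x} (acc rs) with exists-elt? (_⊏? face x)
      ... | no none = x , λ y p → none (y , p)
      ... | yes (face y , p) = go (rs p)

  bot : Face M
  bot = proj₁ minimal-face

  -- Minimal implies least in a lattice: the meet of `face bot` with `x` cannot be strictly below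
  -- `face bot`.
  bot-⊑ : IsBottom M (face bot)
  bot-⊑ x with meet (face bot) x
  ... | m , inj₁ refl , m⊑x , _ = m⊑x
  ... | m , inj₂ p , _ , _ = ⊥-elim (proj₂ minimal-face m p)

  bot-bottom : Bottom M bot
  bot-bottom x = bot-⊑ (face x)

  bottom-unique : ∀ {b} → Bottom M b → b ≡ bot
  bottom-unique b-bot = ≼-antisym (b-bot bot) (bot-bottom _)

  ρ : Elt M → ℕ
  ρ = proj₁ (proj₂ (proj₂ (proj₂ cp)))

  ρ-rank : IsRankFunction M ρ
  ρ-rank = proj₁ (proj₂ (proj₂ (proj₂ (proj₂ cp))))

  ρ-diamond : Diamond M ρ
  ρ-diamond = proj₁ (proj₂ (proj₂ (proj₂ (proj₂ (proj₂ cp)))))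

  ρ-connected : Connectivity M ρ
  ρ-connected = proj₂ (proj₂ (proj₂ (proj₂ (proj₂ (proj₂ cp)))))

  -- A rank function speaks only of chains that start at the bottom, so a chain from `bot` to `x` is
  -- put in front of the given one.
  ρ-chain : ∀ {x y k} → Chain M x y k → ρ y ≡ ρ x + k
  ρ-chain {x} {y} {k} ch with chain (bot-⊑ x)
  ... | l , d = trans (ρ-rank (face bot) bot-⊑ y (l + k) (chain-++ d ch))
    (cong (_+ k) (sym (ρ-rank (face bot) bot-⊑ x l d)))

  ρ-bot : ρ (face bot) ≡ 0
  ρ-bot = ρ-rank (face bot) bot-⊑ _ 0 done

  ρ-cover : ∀ x y → Covers M x y → ρ y ≡ suc (ρ x)
  ρ-cover x y cov = trans (ρ-chain (step cov done)) (ℕₚ.+-comm (ρ x) 1)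

  ρ-mono : ∀ {x y} → x ⊑ y → ρ x ℕ.≤ ρ y
  ρ-mono x⊑y with chain x⊑y
  ... | k , ch = subst (ρ _ ℕ.≤_) (sym (ρ-chain ch)) (ℕₚ.m≤m+n _ k)

  ρ-strict : ∀ x y → x ⊏ y → ρ x ℕ.< ρ y
  ρ-strict x y x⊏y with cover-above x y x⊏y
  ... | c , cov , c⊑y = subst (ℕ._≤ ρ y) (ρ-cover x c cov) (ρ-mono c⊑y)

  cover-of-rank : ∀ x y → x ⊏ y → ρ y ≡ suc (ρ x) → Covers M x y
  cover-of-rank x y x⊏y e = x⊏y , λ z p q → ℕₚ.<⇒≱ (subst (suc (ρ z) ℕ.≤_) e (ρ-strict z y q)) (ρ-strict x z p)

  record Middle (x z : Elt M) : Set where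
    field
      y₁ y₂ : Elt M
      y₁≢y₂ : y₁ ≢ y₂
      x-y₁ : Covers M x y₁
      x-y₂ : Covers M x y₂
      y₁-z : Covers M y₁ z
      y₂-z : Covers M y₂ z
      only : ∀ y → x ⊏ y → y ⊏ z → y ≡ y₁ ⊎ y ≡ y₂

  covers-between : ∀ x y z → ρ z ≡ suc (suc (ρ x)) → x ⊏ y → y ⊏ z → Covers M x y × Covers M y z
  covers-between x y z e p q = cover-of-rank x y p ρy , cover-of-rank y z q (trans e (cong suc (sym ρy)))
    where
    ρy : ρ y ≡ suc (ρ x)
    ρy = ℕₚ.≤-antisym (ℕₚ.≤-pred (subst (suc (ρ y) ℕ.≤_) e (ρ-strict y z q))) (ρ-strict x y p)

  middle : ∀ x z → x ⊏ z → ρ z ≡ suc (suc (ρ x)) → Middle x z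
  middle x z x⊏z e with ρ-diamond x z x⊏z e
  ... | y₁ , y₂ , ne , (p₁ , q₁) , (p₂ , q₂) , only = record
    { y₁ = y₁ ; y₂ = y₂ ; y₁≢y₂ = ne
    ; x-y₁ = proj₁ (covers-between x y₁ z e p₁ q₁) ; x-y₂ = proj₁ (covers-between x y₂ z e p₂ q₂)
    ; y₁-z = proj₂ (covers-between x y₁ z e p₁ q₁) ; y₂-z = proj₂ (covers-between x y₂ z e p₂ q₂)
    ; only = only }

  middle-of : ∀ x y z → Covers M x y → Covers M y z → Middle x z
  middle-of x y z c d = middle x z (⊏-trans x y z (proj₁ c) (proj₁ d)) (trans (ρ-cover y z d) (cong suc (ρ-cover x y c)))

  no-third : ∀ x z f g h → ρ z ≡ suc (suc (ρ x)) → x ⊏ f → f ⊏ z → x ⊏ g → g ⊏ z → x ⊏ h → h ⊏ z →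
    f ≢ g → f ≢ h → g ≢ h → ⊥
  no-third x z f g h e xf fz xg gz xh hz fg fh gh with middle x z (⊏-trans x f z xf fz) e
  ... | mid with Middle.only mid _ xf fz | Middle.only mid _ xg gz | Middle.only mid _ xh hz
  ... | inj₁ refl | inj₁ refl | _ = fg refl
  ... | inj₁ refl | inj₂ refl | inj₁ refl = fh refl
  ... | inj₁ refl | inj₂ refl | inj₂ refl = gh refl
  ... | inj₂ refl | inj₂ refl | _ = fg refl
  ... | inj₂ refl | inj₁ refl | inj₂ refl = fh refl
  ... | inj₂ refl | inj₁ refl | inj₁ refl = gh refl

  -- A join strictly below `z` would have to be `y₁`, since `z` covers `y₁`; then `y₂` is strictly
  -- below `y₁`, although `z` covers `y₂` too.
  middle-join : ∀ {x z} (m : Middle x z) → IsJoin M (Middle.y₁ m) (Middle.y₂ m) z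
  middle-join {x} {z} m = inj₂ (proj₁ y₁-z) , inj₂ (proj₁ y₂-z) , λ w p q → ⊑-trans (top w p q) (proj₂ (proj₂ (proj₂ j)) w p q)
    where
    open Middle m
    j = join y₁ y₂
    j⊑z = proj₂ (proj₂ (proj₂ j)) z (inj₂ (proj₁ y₁-z)) (inj₂ (proj₁ y₂-z))
    top : ∀ w → y₁ ⊑ w → y₂ ⊑ w → z ⊑ proj₁ j
    top w _ _ with j⊑z | proj₁ (proj₂ j)
    ... | inj₁ e | _ = inj₁ (sym e)
    ... | inj₂ j⊏z | inj₂ y₁⊏j = ⊥-elim (proj₂ y₁-z _ y₁⊏j j⊏z)
    ... | inj₂ j⊏z | inj₁ e = ⊥-elim (proj₂ y₂-z _ (⊑∧≢⇒⊏ (subst (y₂ ⊑_) (sym e) (proj₁ (proj₂ (proj₂ j)))) (y₁≢y₂ ∘ sym)) (proj₁ y₁-z))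

  middle-meet : ∀ {x z} (m : Middle x z) → IsMeet M (Middle.y₁ m) (Middle.y₂ m) x
  middle-meet {x} {z} m = inj₂ (proj₁ x-y₁) , inj₂ (proj₁ x-y₂) , λ w p q → ⊑-trans (proj₂ (proj₂ (proj₂ j)) w p q) low
    where
    open Middle m
    j = meet y₁ y₂
    x⊑j = proj₂ (proj₂ (proj₂ j)) x (inj₂ (proj₁ x-y₁)) (inj₂ (proj₁ x-y₂))
    low : proj₁ j ⊑ x
    low with x⊑j | proj₁ (proj₂ j)
    ... | inj₁ e | _ = inj₁ (sym e)
    ... | inj₂ x⊏j | inj₂ j⊏y₁ = ⊥-elim (proj₂ x-y₁ _ x⊏j j⊏y₁)
    ... | inj₂ x⊏j | inj₁ e = ⊥-elim (proj₂ x-y₂ _ (proj₁ x-y₁) (⊑∧≢⇒⊏ (subst (_⊑ y₂) e (proj₁ (proj₂ (proj₂ j)))) y₁≢y₂))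

  Vertex : Face M → Set
  Vertex = IsVertex M

  Facet : Face M → Set
  Facet = IsFacet M

  covers-bot⇒vertex : ∀ {v} → Covers M (face bot) (face v) → Vertex v
  covers-bot⇒vertex cov = face bot , bot-⊑ , cov

  vertex⇒covers-bot : ∀ {v} → Vertex v → Covers M (face bot) (face v)
  vertex⇒covers-bot (b , b-bot , cov) with ⊑-antisym (b-bot (face bot)) (bot-⊑ b)
  ... | refl = cov

  vertex? : Decidable Vertex
  vertex? v = map′ covers-bot⇒vertex vertex⇒covers-bot
    ((face bot ⊏? face v) ×-dec forall-elt? λ z → (face bot ⊏? z) →-dec ¬? (z ⊏? face v))

  facet? : Decidable Facet
  facet? f = yes tt ×-dec forall-elt? λ z → (face f ⊏? z) →-dec ¬? (z ⊏? 𝟏)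

  vertex≢bot : ∀ {v} → Vertex v → v ≢ bot
  vertex≢bot vv refl = ⊏-irrefl (face bot) (proj₁ (vertex⇒covers-bot vv))

  -- Every face of rank at least two is the join of two faces it covers.
  shadow-⊑ : ∀ {x} y → (∀ v → Vertex v → v ≼ x → face v ⊑ y) → face x ⊑ y
  shadow-⊑ {x} y = go (⊏-wf (face x))
    where
    go : ∀ {x} → Acc _⊏_ (face x) → (∀ v → Vertex v → v ≼ x → face v ⊑ y) → face x ⊑ y
    go {x} (acc rs) h with bot-⊑ (face x)
    ... | inj₁ refl = bot-⊑ y
    ... | inj₂ p with cover-below (face bot) (face x) p
    ... | c , inj₁ refl , cov = h x (covers-bot⇒vertex cov) ⊑-refl
    ... | c , inj₂ q , cov with cover-below (face bot) c q
    ... | d , _ , cov′ = rec (Middle.y₁ mid) (Middle.y₂ mid) (Middle.y₁-z mid) (Middle.y₂-z mid) (middle-join mid)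
      where
      mid = middle-of d c (face x) cov′ cov
      rec : ∀ y₁ y₂ → Covers M y₁ (face x) → Covers M y₂ (face x) → IsJoin M y₁ y₂ (face x) → face x ⊑ y
      rec (face u) (face w) c₁ c₂ (_ , _ , least) = least y
        (go (rs (proj₁ c₁)) λ v vv p → h v vv (inj₂ (⊑-⊏-trans (face x) p (proj₁ c₁))))
        (go (rs (proj₁ c₂)) λ v vv p → h v vv (inj₂ (⊑-⊏-trans (face x) p (proj₁ c₂))))
      rec 𝟏 _ (() , _)
      rec (face _) 𝟏 _ (() , _)

  shadow-≼ : ∀ {x y} → (∀ v → Vertex v → v ≼ x → v ≼ y) → x ≼ y
  shadow-≼ {y = y} = shadow-⊑ (face y)

  shadow-injective : ∀ {x y} → (∀ v → Vertex v → v ≼ x → v ≼ y) → (∀ v → Vertex v → v ≼ y → v ≼ x) → x ≡ y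
  shadow-injective p q = ≼-antisym (shadow-≼ p) (shadow-≼ q)

  no-vertex⇒bot : ∀ {x} → (∀ v → Vertex v → ¬ (v ≼ x)) → x ≡ bot
  no-vertex⇒bot h = ≼-antisym (shadow-≼ λ v vv p → ⊥-elim (h v vv p)) (bot-bottom _)

  -- Dually, a face that is not a facet is the meet of two faces covering it.
  cofacets-⊑ : ∀ x y → (∀ f → Facet f → y ⊑ face f → x ⊑ face f) → x ⊑ y
  cofacets-⊑ x y = go (⊐-wf y)
    where
    go : ∀ {y} → Acc (flip _⊏_) y → (∀ f → Facet f → y ⊑ face f → x ⊑ face f) → x ⊑ y
    go {𝟏} _ h = ⊑𝟏 x
    go {face y} (acc rs) h with cover-above (face y) 𝟏 tt
    ... | 𝟏 , cov , _ = h y cov ⊑-refl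
    ... | face c , cov , _ with cover-above (face c) 𝟏 tt
    ... | d , cov′ , _ = proj₂ (proj₂ (middle-meet mid)) x
        (go (rs (proj₁ (Middle.x-y₁ mid))) λ f fac p → h f fac (inj₂ (⊏-⊑-trans (face y) (proj₁ (Middle.x-y₁ mid)) p)))
        (go (rs (proj₁ (Middle.x-y₂ mid))) λ f fac p → h f fac (inj₂ (⊏-⊑-trans (face y) (proj₁ (Middle.x-y₂ mid)) p)))
      where mid = middle-of (face y) (face c) d cov cov′

  facet-above : ∀ x → ∃ λ f → Facet f × x ≼ f
  facet-above x with cover-below (face x) 𝟏 tt
  ... | face f , p , cov = f , cov , p

  facet-avoiding : ∀ {x y} → ¬ (x ≼ y) → ∃ λ f → Facet f × y ≼ f × ¬ (x ≼ f)
  facet-avoiding {x} {y} x⋠y with exists-face? (λ f → facet? f ×-dec ((y ≼? f) ×-dec ¬? (x ≼? f)))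
  ... | yes p = p
  ... | no none = ⊥-elim (x⋠y (cofacets-⊑ (face x) (face y) λ f fac y≼f →
    decidable-stable (x ≼? f) λ x⋠f → none (f , fac , y≼f , x⋠f)))

  facet-avoiding-vertex : ∀ {v} → Vertex v → ∃ λ f → Facet f × ¬ (v ≼ f)
  facet-avoiding-vertex {v} vv with facet-avoiding {v} {bot} (λ p → vertex≢bot vv (≼-antisym p (bot-bottom v)))
  ... | f , fac , _ , v⋠f = f , fac , v⋠f

  infixr 7 _∧_
  face-meet : ∀ x y → ∃ λ m → IsMeet M (face x) (face y) (face m)
  face-meet x y with meet (face x) (face y)
  ... | face m , p = m , p
  ... | 𝟏 , inj₁ () , _
  ... | 𝟏 , inj₂ () , _

  _∧_ : Face M → Face M → Face M
  x ∧ y = proj₁ (face-meet x y)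

  ∧-lower₁ : ∀ x y → x ∧ y ≼ x
  ∧-lower₁ x y = proj₁ (proj₂ (face-meet x y))

  ∧-lower₂ : ∀ x y → x ∧ y ≼ y
  ∧-lower₂ x y = proj₁ (proj₂ (proj₂ (face-meet x y)))

  ∧-greatest : ∀ {x y z} → z ≼ x → z ≼ y → z ≼ x ∧ y
  ∧-greatest {x} {y} = proj₂ (proj₂ (proj₂ (face-meet x y))) _

-- How facets meet a reducible class

module ReducibleClass (M : FacePoset) (cp : IsCellularPseudomanifold M) (x₀ : Face M) where

  open Order M using () renaming (_<_ to infix 4 _⊏_; _≤_ to infix 4 _⊑_)
  open Pseudomanifold M cp x₀

  module Swapping {c d : Face M} (swap : Swap M c d) where

    private
      φ = proj₁ swap
    open _≃_ φ public using (to)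
    open _≃_ φ using (to-≼; to-≼⁻¹)

    to-c : to c ≡ d
    to-c = proj₁ (proj₂ swap)

    to-d : to d ≡ c
    to-d = proj₁ (proj₂ (proj₂ swap))

    to-other : ∀ {v} → Vertex v → v ≢ c → v ≢ d → to v ≡ v
    to-other = proj₂ (proj₂ (proj₂ swap)) _

    other : ∀ {v α} → Vertex v → v ≢ c → v ≢ d → v ≼ α → v ≼ to α
    other {v} {α} vv v≢c v≢d p = subst (_≼ to α) (to-other vv v≢c v≢d) (to-≼ p)

    other⁻¹ : ∀ {v α} → Vertex v → v ≢ c → v ≢ d → v ≼ to α → v ≼ α
    other⁻¹ {v} {α} vv v≢c v≢d p = to-≼⁻¹ (subst (_≼ to α) (sym (to-other vv v≢c v≢d)) p)

    c⇒d : ∀ {α} → c ≼ α → d ≼ to α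
    c⇒d {α} p = subst (_≼ to α) to-c (to-≼ p)

    d⇒c : ∀ {α} → d ≼ α → c ≼ to α
    d⇒c {α} p = subst (_≼ to α) to-d (to-≼ p)

    d⇐c : ∀ {α} → c ≼ to α → d ≼ α
    d⇐c {α} p = to-≼⁻¹ (subst (_≼ to α) (sym to-d) p)

  swap-of : ∀ {y z} → y ≢ z → Similar M y z → Swap M y z
  swap-of y≢z (inj₁ y≡z) = ⊥-elim (y≢z y≡z)
  swap-of y≢z (inj₂ s) = s

  separated : ∀ {v x y} → v ≼ x → ¬ (v ≼ y) → x ≢ y
  separated p q refl = q p

  -- The face f ∖ c is covered by f, by (c y)f and by (c z)f.
  facet-hits-pair : ∀ {f c y z} → Facet f → Vertex c → Vertex y → Vertex z →
    Similar M c y → Similar M c z → y ≢ z → c ≼ f → ¬ (y ≼ f) → ¬ (z ≼ f) → ⊥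
  facet-hits-pair {f} {c} {y} {z} fac vc vy vz sy sz y≢z c≼f y⋠f z⋠f =
    no-third (face m) 𝟏 (face f) (face (φ.to f)) (face (ψ.to f))
      (trans (ρ-cover (face f) 𝟏 fac) (cong suc (ρ-cover (face m) (face f) (m⊏f , nothing-between))))
      m⊏f tt
      (⊑∧≢⇒⊏ (∧-lower₂ f (φ.to f)) (λ e → separated (φ.c⇒d c≼f) y⋠m (sym (face-injective e)))) tt
      (⊑∧≢⇒⊏ m≼ψf (λ e → separated (ψ.c⇒d c≼f) z⋠m (sym (face-injective e)))) tt
      (λ e → separated (φ.c⇒d c≼f) y⋠f (sym (face-injective e)))
      (λ e → separated (ψ.c⇒d c≼f) z⋠f (sym (face-injective e)))
      -- The two images differ at `y`: `φ` brings it in as the image of `c`, whereas `ψ` fixes it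
      -- and `f` omits it.
      (λ e → separated (φ.c⇒d c≼f) (λ p → y⋠f (ψ.other⁻¹ vy y≢c y≢z p)) (face-injective e))
    where
    y≢c : y ≢ c
    y≢c refl = y⋠f c≼f
    z≢c : z ≢ c
    z≢c refl = z⋠f c≼f
    module φ = Swapping (swap-of (y≢c ∘ sym) sy)
    module ψ = Swapping (swap-of (z≢c ∘ sym) sz)
    m = f ∧ φ.to f
    c⋠m : ¬ (c ≼ m)
    c⋠m p = y⋠f (φ.d⇐c (⊑-trans p (∧-lower₂ f (φ.to f))))
    y⋠m : ¬ (y ≼ m)
    y⋠m p = y⋠f (⊑-trans p (∧-lower₁ f (φ.to f)))
    z⋠m : ¬ (z ≼ m)
    z⋠m p = z⋠f (⊑-trans p (∧-lower₁ f (φ.to f)))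
    to-m : ∀ {v} → Vertex v → v ≢ c → v ≼ f → v ≼ m
    to-m {v} vv v≢c v≼f = ∧-greatest v≼f (φ.other vv v≢c (λ { refl → y⋠f v≼f }) v≼f)
    m⊏f : face m ⊏ face f
    m⊏f = ⊑∧≢⇒⊏ (∧-lower₁ f (φ.to f)) (λ e → separated c≼f c⋠m (sym (face-injective e)))
    nothing-between : ∀ k → face m ⊏ k → ¬ (k ⊏ face f)
    -- The face `m` lacks only the vertex `c` of `f`, so the position of `k` depends on `c` alone.
    nothing-between (face k) m⊏k k⊏f with c ≼? k
    ... | yes c≼k = ⊏-irrefl (face f) (⊑-⊏-trans (face f) (shadow-≼ all-in) k⊏f)
      where
      all-in : ∀ v → Vertex v → v ≼ f → v ≼ k
      all-in v vv v≼f with v ≟ᶠ c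
      ... | yes refl = c≼k
      ... | no v≢c = ⊑-trans (to-m vv v≢c v≼f) (inj₂ m⊏k)
    ... | no c⋠k = ⊏-irrefl (face m) (⊏-⊑-trans (face m) m⊏k (shadow-≼ λ v vv v≼k →
      to-m vv (λ { refl → c⋠k v≼k }) (⊑-trans v≼k (inj₂ k⊏f))))
    m≼ψf : m ≼ ψ.to f
    m≼ψf = shadow-≼ λ v vv v≼m → ψ.other vv (λ { refl → c⋠m v≼m }) (λ { refl → z⋠m v≼m })
      (⊑-trans v≼m (∧-lower₁ f (φ.to f)))

  facet-rank : ∀ {f} → Facet f → ρ 𝟏 ≡ suc (ρ (face f))
  facet-rank {f} fac = ρ-cover (face f) 𝟏 fac

  facet-ΛVertex : ∀ {f} → Facet f → ΛVertex M ρ (face bot) 𝟏 (face f)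
  facet-ΛVertex {f} fac = bot-bottom f , inj₂ tt , sym (facet-rank fac)

  -- For rank 2, where Connectivity is silent, any two facets are adjacent.
  facets-connected : ∀ {x} → Vertex x → ∀ {f g} → Facet f → Facet g →
    Star (ΛEdge M ρ (face bot) 𝟏) (face f) (face g)
  facets-connected {x} vx {f} {g} facf facg with 3 ℕ.≤? ρ 𝟏
  ... | yes 3≤ρ = ρ-connected (face bot) 𝟏 tt (subst (λ k → suc (suc (suc k)) ℕ.≤ ρ 𝟏) (sym ρ-bot) 3≤ρ)
    (face f) (face g) (facet-ΛVertex facf) (facet-ΛVertex facg)
  ... | no 3≰ρ with f ≟ᶠ g
  ... | yes refl = ε
  ... | no f≢g = (facet-ΛVertex facf , facet-ΛVertex facg , (f≢g ∘ face-injective) ,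
      face (f ∧ g) , proj₂ (face-meet f g) , trans (cong (2 +_) ρm) (sym ρ𝟏)) ◅ ε
    where
    ρx : ρ (face x) ≡ 1
    ρx = trans (ρ-cover (face bot) (face x) (vertex⇒covers-bot vx)) (cong suc ρ-bot)
    ρ𝟏 : ρ 𝟏 ≡ 2
    ρ𝟏 = ℕₚ.≤-antisym (ℕₚ.≤-pred (ℕₚ.≰⇒> 3≰ρ)) (subst (λ k → suc k ℕ.≤ ρ 𝟏) ρx (ρ-strict (face x) 𝟏 tt))
    ρf : ρ (face f) ≡ 1
    ρf = ℕₚ.suc-injective (trans (sym (facet-rank facf)) ρ𝟏)
    m≢f : f ∧ g ≢ f
    m≢f e with subst (_≼ g) e (∧-lower₂ f g)
    ... | inj₁ p = f≢g (face-injective p)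
    ... | inj₂ f≺g = facet-elim M facf g f≺g
    ρm : ρ (face (f ∧ g)) ≡ 0
    ρm = ℕₚ.n≤0⇒n≡0 (ℕₚ.≤-pred (subst (suc (ρ (face (f ∧ g))) ℕ.≤_) ρf
      (ρ-strict (face (f ∧ g)) (face f) (⊑∧≢⇒⊏ (∧-lower₁ f g) (m≢f ∘ face-injective)))))

  rank-pred⇒facet : ∀ {f} → suc (ρ (face f)) ≡ ρ 𝟏 → Facet f
  rank-pred⇒facet {f} e = cover-of-rank (face f) 𝟏 tt (sym e)

  module Class {x : Face M} (vx : Vertex x) (red : ReducibleAt M x) where

    similar : ∀ {y z} → Vertex y → Vertex z → Similar M x y → Similar M x z → Similar M y z
    similar vy vz sy sz = Similar-trans M _≟ᶠ_ vx vy vz (Similar-sym M sy) sz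

    -- Formulated on `Elt`, where the paths of Λ run, so that it can be carried along them.
    Misses : Elt M → Set
    Misses σ = ∀ c → Vertex c → Similar M x c → ¬ (face c ⊑ σ)

    -- A ridge disjoint from the class between a facet disjoint from it and
    -- a facet g meeting it would also lie in an image of g.
    misses-edge : ∀ {σ γ} → ΛEdge M ρ (face bot) 𝟏 σ γ → Misses σ → Misses γ
    misses-edge {face s} {face g} ((_ , _ , es) , (_ , _ , eg) , s≢g , face m , (m⊑s , m⊑g , _) , em) miss c vc sc c≼g =
      -- Against `red`, the whole class is forced into `g`: a member `d` outside `g` would make the
      -- image of `g` under (c d) a third facet above the ridge `m`, besides `s` and `g`.
      red g (rank-pred⇒facet eg) λ d vd sd → decidable-stable (d ≼? g) (absurd d vd sd)
      where
      strict : ∀ k → face m ⊑ k → suc (ρ k) ≡ ρ 𝟏 → face m ⊏ k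
      strict k p e = ⊑∧≢⇒⊏ p λ { refl → ℕₚ.1+n≢n (trans em (sym e)) }
      absurd : ∀ d → Vertex d → Similar M x d → ¬ ¬ (d ≼ g)
      absurd d vd sd d⋠g = no-third (face m) 𝟏 (face s) (face g) (face (φ.to g)) (sym em)
        (strict (face s) m⊑s es) tt (strict (face g) m⊑g eg) tt
        (⊑∧≢⇒⊏ m≼φg (λ e → separated (φ.c⇒d c≼g) d⋠m (sym (face-injective e)))) tt
        s≢g
        (λ e → separated (φ.c⇒d c≼g) (miss d vd sd) (sym (face-injective e)))
        (λ e → separated (φ.c⇒d c≼g) d⋠g (sym (face-injective e)))
        where
        c≢d : c ≢ d
        c≢d refl = d⋠g c≼g
        module φ = Swapping (swap-of c≢d (similar vc vd sc sd))
        d⋠m : ¬ (d ≼ m)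
        d⋠m p = miss d vd sd (⊑-trans p m⊑s)
        m≼φg : m ≼ φ.to g
        m≼φg = shadow-≼ λ v vv v≼m → φ.other vv (λ { refl → miss c vc sc (⊑-trans v≼m m⊑s) })
          (λ { refl → d⋠m v≼m }) (⊑-trans v≼m m⊑g)
    misses-edge {𝟏} ((_ , _ , es) , _) _ _ _ _ _ = ℕₚ.1+n≢n es
    misses-edge {face _} {𝟏} (_ , (_ , _ , eg) , _) _ _ _ _ _ = ℕₚ.1+n≢n eg
    misses-edge {face _} {face _} (_ , _ , _ , 𝟏 , (inj₁ () , _) , _)
    misses-edge {face _} {face _} (_ , _ , _ , 𝟏 , (inj₂ () , _) , _)

    misses-path : ∀ {σ γ} → Star (ΛEdge M ρ (face bot) 𝟏) σ γ → Misses σ → Misses γ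
    misses-path ε miss = miss
    misses-path (_◅_ {j = j} e es) miss = misses-path es (misses-edge {_} {j} e miss)

    -- If `f` omits both `y` and `z`, then `facet-hits-pair` leaves no member of the class in `f`.
    -- Along Λ this absence spreads to every facet, including one above `x`, which does contain a
    -- member.
    facet-hits : ∀ {f y z} → Facet f → Vertex y → Vertex z → Similar M x y → Similar M x z → y ≢ z → ¬ (y ≼ f) → z ≼ f
    facet-hits {f} {y} {z} fac vy vz sy sz y≢z y⋠f = decidable-stable (z ≼? f) λ z⋠f →
      let g , facg , x≼g = facet-above x in
      misses-path (facets-connected vx fac facg)
        (λ c vc sc c≼f → facet-hits-pair fac vc vy vz (similar vc vy sc sy) (similar vc vz sc sz) y≢z c≼f y⋠f z⋠f)
        x vx (inj₁ refl) x≼g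

-- Upper intervals of a pseudomanifold

-- This presents `N` as the interval from `e least` to the common top `𝟏`. By `upper` every interval
-- of `M` that starts in the image stays in it, so covers, diamonds and Λ are the same in both.
record UpperEmbedding (N M : FacePoset) : Set where
  field
    e         : Face N → Face M
    injective : ∀ {x y} → e x ≡ e y → x ≡ y
    mono      : ∀ {x y} → x ≺[ N ] y → e x ≺[ M ] e y
    reflects  : ∀ {x y} → e x ≺[ M ] e y → x ≺[ N ] y
    upper     : ∀ x {y} → e x ≺[ M ] y → Σ (Face N) λ x′ → e x′ ≡ y
    least     : Face N
    least-bottom : Bottom N least

module UpperSet (N M : FacePoset) (emb : UpperEmbedding N M) (cp : IsCellularPseudomanifold M) where

  open UpperEmbedding emb
  open Order M using () renaming (_<_ to infix 4 _⊏_; _≤_ to infix 4 _⊑_)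
  open Order N using () renaming (_<_ to infix 4 _⊏ₙ_; _≤_ to infix 4 _⊑ₙ_)
  open Pseudomanifold M cp (e least)

  e⁺ : Elt N → Elt M
  e⁺ (face x) = face (e x)
  e⁺ 𝟏 = 𝟏

  e⁺-injective : ∀ x y → e⁺ x ≡ e⁺ y → x ≡ y
  e⁺-injective (face x) (face y) p = cong face (injective (face-injective p))
  e⁺-injective 𝟏 𝟏 _ = refl

  e⁺-⊏ : ∀ x y → x ⊏ₙ y → e⁺ x ⊏ e⁺ y
  e⁺-⊏ (face x) (face y) p = mono p
  e⁺-⊏ (face x) 𝟏 _ = tt

  e⁺-⊏⁻¹ : ∀ x y → e⁺ x ⊏ e⁺ y → x ⊏ₙ y
  e⁺-⊏⁻¹ (face x) (face y) p = reflects p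
  e⁺-⊏⁻¹ (face x) 𝟏 _ = tt

  e⁺-⊑ : ∀ {x y} → x ⊑ₙ y → e⁺ x ⊑ e⁺ y
  e⁺-⊑ (inj₁ p) = inj₁ (cong e⁺ p)
  e⁺-⊑ {x} {y} (inj₂ p) = inj₂ (e⁺-⊏ x y p)

  e⁺-⊑⁻¹ : ∀ x y → e⁺ x ⊑ e⁺ y → x ⊑ₙ y
  e⁺-⊑⁻¹ x y (inj₁ p) = inj₁ (e⁺-injective x y p)
  e⁺-⊑⁻¹ x y (inj₂ p) = inj₂ (e⁺-⊏⁻¹ x y p)

  e⁺-upper : ∀ x y → e⁺ x ⊑ y → Σ (Elt N) λ x′ → e⁺ x′ ≡ y
  e⁺-upper x _ (inj₁ p) = x , p
  e⁺-upper _ 𝟏 (inj₂ _) = 𝟏 , refl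
  e⁺-upper (face x) (face y) (inj₂ p) with upper x p
  ... | x′ , refl = face x′ , refl

  0ₙ : Elt N
  0ₙ = face least

  0ₙ-⊑ : ∀ x → 0ₙ ⊑ₙ x
  0ₙ-⊑ (face x) = least-bottom x
  0ₙ-⊑ 𝟏 = inj₂ tt

  0ₙ-unique : ∀ b → IsBottom N b → b ≡ 0ₙ
  0ₙ-unique b b-bot = e⁺-injective b 0ₙ (⊑-antisym (e⁺-⊑ (b-bot 0ₙ)) (e⁺-⊑ (0ₙ-⊑ b)))

  finiteₙ : IsFinite N
  finiteₙ = (size , mk↔ₛ′ code decode code-decode decode-code) ,
    λ x y → map′ reflects mono (proj₂ (proj₁ cp) (e x) (e y))
    where
    above : Enumeration (λ y → e least ≼ y)
    above = enumerate finite (e least ≼?_)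
    open Enumeration above renaming (injective to at-injective)
    code : Face N → Fin size
    code x = position (e x) (e⁺-⊑ (least-bottom x))
    preimage : ∀ i → Σ (Face N) λ x → e x ≡ at i
    preimage i with e⁺-upper 0ₙ (face (at i)) (sound i)
    ... | face x , p = x , face-injective p
    decode : Fin size → Face N
    decode i = proj₁ (preimage i)
    code-decode : ∀ i → code (decode i) ≡ i
    code-decode i = at-injective (trans (at-position _ _) (proj₂ (preimage i)))
    decode-code : ∀ x → decode (code x) ≡ x
    decode-code x = injective (trans (proj₂ (preimage (code x))) (at-position _ _))

  e⁺-meet⁻¹ : ∀ x y m → IsMeet M (e⁺ x) (e⁺ y) (e⁺ m) → IsMeet N x y m
  e⁺-meet⁻¹ x y m (p , q , r) = e⁺-⊑⁻¹ m x p , e⁺-⊑⁻¹ m y q , λ z s t → e⁺-⊑⁻¹ z m (r (e⁺ z) (e⁺-⊑ s) (e⁺-⊑ t))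

  latticeₙ : IsLattice N
  latticeₙ = meetₙ , joinₙ
    where
    meetₙ : ∀ x y → ∃ λ m → IsMeet N x y m
    meetₙ x y with meet (e⁺ x) (e⁺ y)
    ... | m , p with e⁺-upper 0ₙ m (proj₂ (proj₂ p) (e⁺ 0ₙ) (e⁺-⊑ (0ₙ-⊑ x)) (e⁺-⊑ (0ₙ-⊑ y)))
    ... | m′ , refl = m′ , e⁺-meet⁻¹ x y m′ p
    joinₙ : ∀ x y → ∃ λ j → IsJoin N x y j
    joinₙ x y with join (e⁺ x) (e⁺ y)
    ... | j , (p , q , r) with e⁺-upper x j p
    ... | j′ , refl = j′ , (e⁺-⊑⁻¹ x j′ p , e⁺-⊑⁻¹ y j′ q , λ z s t → e⁺-⊑⁻¹ j′ z (r (e⁺ z) (e⁺-⊑ s) (e⁺-⊑ t)))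

  e⁺-covers : ∀ x y → Covers N x y → Covers M (e⁺ x) (e⁺ y)
  e⁺-covers x y (p , q) = e⁺-⊏ x y p , none
    where
    none : ∀ z → e⁺ x ⊏ z → ¬ (z ⊏ e⁺ y)
    none z r s with e⁺-upper x z (inj₂ r)
    ... | z′ , refl = q z′ (e⁺-⊏⁻¹ x z′ r) (e⁺-⊏⁻¹ z′ y s)

  e⁺-chain : ∀ {x y k} → Chain N x y k → Chain M (e⁺ x) (e⁺ y) k
  e⁺-chain done = done
  e⁺-chain (step {x} {y} cov ch) = step (e⁺-covers x y cov) (e⁺-chain ch)

  r₀ : ℕ
  r₀ = ρ (e⁺ 0ₙ)

  -- The bottom of `N` has rank `r₀` in `M`. Truncation does no harm, since all elements of the
  -- image have rank at least `r₀`.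
  ρₙ : Elt N → ℕ
  ρₙ x = ρ (e⁺ x) ℕ.∸ r₀

  ρ-e⁺ : ∀ x → ρ (e⁺ x) ≡ ρₙ x + r₀
  ρ-e⁺ x = sym (ℕₚ.m∸n+n≡m (ρ-mono (e⁺-⊑ (0ₙ-⊑ x))))

  ρ-shift : ∀ k x z → k + ρₙ x ≡ ρₙ z → k + ρ (e⁺ x) ≡ ρ (e⁺ z)
  ρ-shift k x z p = trans (cong (k +_) (ρ-e⁺ x)) (trans (sym (ℕₚ.+-assoc k _ _)) (trans (cong (_+ r₀) p) (sym (ρ-e⁺ z))))

  ρ-shift⁻¹ : ∀ k x z → k + ρ (e⁺ x) ≡ ρ (e⁺ z) → k + ρₙ x ≡ ρₙ z
  ρ-shift⁻¹ k x z p = ℕₚ.+-cancelʳ-≡ r₀ _ _ (trans (ℕₚ.+-assoc k _ _) (trans (cong (k +_) (sym (ρ-e⁺ x))) (trans p (ρ-e⁺ z))))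

  rankₙ : IsRankFunction N ρₙ
  rankₙ b b-bot x k ch with 0ₙ-unique b b-bot
  ... | refl = trans (cong (ℕ._∸ r₀) (ρ-chain (e⁺-chain ch))) (ℕₚ.m+n∸m≡n r₀ k)

  diamondₙ : Diamond N ρₙ
  diamondₙ x z p q with ρ-diamond (e⁺ x) (e⁺ z) (e⁺-⊏ x z p) (sym (ρ-shift 2 x z (sym q)))
  ... | y₁ , y₂ , ne , (a₁ , b₁) , (a₂ , b₂) , only with e⁺-upper x y₁ (inj₂ a₁) | e⁺-upper x y₂ (inj₂ a₂)
  ... | u₁ , refl | u₂ , refl = u₁ , u₂ , (λ { refl → ne refl }) ,
    (e⁺-⊏⁻¹ x u₁ a₁ , e⁺-⊏⁻¹ u₁ z b₁) , (e⁺-⊏⁻¹ x u₂ a₂ , e⁺-⊏⁻¹ u₂ z b₂) , onlyₙ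
    where
    onlyₙ : ∀ y → x ⊏ₙ y → y ⊏ₙ z → y ≡ u₁ ⊎ y ≡ u₂
    onlyₙ y r s with only (e⁺ y) (e⁺-⊏ x y r) (e⁺-⊏ y z s)
    ... | inj₁ t = inj₁ (e⁺-injective y u₁ t)
    ... | inj₂ t = inj₂ (e⁺-injective y u₂ t)

  connectedₙ : Connectivity N ρₙ
  connectedₙ x z p q σ γ vσ vγ = path σ γ
    (ρ-connected (e⁺ x) (e⁺ z) (e⁺-⊏ x z p) large (e⁺ σ) (e⁺ γ) (Λ-e⁺ σ vσ) (Λ-e⁺ γ vγ)) refl
    where
    large : 3 + ρ (e⁺ x) ℕ.≤ ρ (e⁺ z)
    large = subst₂ ℕ._≤_ (cong (3 +_) (sym (ρ-e⁺ x))) (sym (ρ-e⁺ z)) (ℕₚ.+-monoˡ-≤ r₀ q)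
    Λ-e⁺ : ∀ y → ΛVertex N ρₙ x z y → ΛVertex M ρ (e⁺ x) (e⁺ z) (e⁺ y)
    Λ-e⁺ y (a , b , c) = e⁺-⊑ a , e⁺-⊑ b , ρ-shift 1 y z c
    Λ-e⁺⁻¹ : ∀ y → ΛVertex M ρ (e⁺ x) (e⁺ z) (e⁺ y) → ΛVertex N ρₙ x z y
    Λ-e⁺⁻¹ y (a , b , c) = e⁺-⊑⁻¹ x y a , e⁺-⊑⁻¹ y z b , ρ-shift⁻¹ 1 y z c
    -- The end point is a variable `τ` with an equation because an index `e⁺ γ` could not be matched
    -- against `ε`. Each next element lies above `e⁺ x`, hence so does each meet, and both come from
    -- `N`.
    path : ∀ σ γ {τ} → Star (ΛEdge M ρ (e⁺ x) (e⁺ z)) (e⁺ σ) τ → τ ≡ e⁺ γ → Star (ΛEdge N ρₙ x z) σ γ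
    path σ γ ε eq with e⁺-injective σ γ eq
    ... | refl = ε
    path σ γ (_◅_ {j = j} (vσ , vj , ne , m , meet , em) es) eq
      with e⁺-upper x j (proj₁ vj) | e⁺-upper x m (proj₂ (proj₂ meet) (e⁺ x) (proj₁ vσ) (proj₁ vj))
    ... | j′ , refl | m′ , refl =
      (Λ-e⁺⁻¹ σ vσ , Λ-e⁺⁻¹ j′ vj , (λ { refl → ne refl }) , m′ , e⁺-meet⁻¹ σ j′ m′ meet , ρ-shift⁻¹ 2 m′ z em)
      ◅ path j′ γ es eq

  abstract
    pseudomanifold : IsCellularPseudomanifold N
    pseudomanifold = finiteₙ ,
      ((λ x p → ⊏-irrefl (e⁺ x) (e⁺-⊏ x x p)) ,
       (λ x y z p q → e⁺-⊏⁻¹ x z (⊏-trans (e⁺ x) (e⁺ y) (e⁺ z) (e⁺-⊏ x y p) (e⁺-⊏ y z q)))) ,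
      latticeₙ , ρₙ , rankₙ , diamondₙ , connectedₙ

-- The inverse of an isomorphism is an upper embedding whose image is everything.
≃-pseudomanifold : ∀ {M N} → M ≃ N → Face M → IsCellularPseudomanifold M → IsCellularPseudomanifold N
≃-pseudomanifold {M} {N} φ x₀ cp = UpperSet.pseudomanifold N M (record
  { e = from ; injective = _≃_.to-injective (≃-sym φ) ; mono = from-≺ ; reflects = _≃_.to-≺⁻¹ (≃-sym φ)
  ; upper = λ x {y} _ → to y , from-to y
  ; least = to bot ; least-bottom = ≃-bottom φ bot-bottom }) cp
  where
  open _≃_ φ
  open Pseudomanifold M cp x₀ using (bot; bot-bottom)

-- Joins

*-≼ : ∀ A B {x x′ y y′} → x ≼[ A ] x′ → y ≼[ B ] y′ → (x , y) ≼[ A * B ] (x′ , y′)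
*-≼ A B (inj₁ refl) (inj₁ refl) = inj₁ refl
*-≼ A B p (inj₂ q) = inj₂ (inj₁ (p , q))
*-≼ A B (inj₂ p) q = inj₂ (inj₂ (p , q))

*-≼⁻¹ : ∀ A B {x x′ y y′} → (x , y) ≼[ A * B ] (x′ , y′) → x ≼[ A ] x′ × y ≼[ B ] y′
*-≼⁻¹ A B (inj₁ refl) = inj₁ refl , inj₁ refl
*-≼⁻¹ A B (inj₂ (inj₁ (p , q))) = p , inj₂ q
*-≼⁻¹ A B (inj₂ (inj₂ (p , q))) = inj₂ p , q

*-comm : ∀ A B → A * B ≃ B * A
*-comm A B = record
  { to = λ (x , y) → y , x ; from = λ (y , x) → x , y ; to-from = λ _ → refl ; from-to = λ _ → refl
  ; to-≺ = λ { (inj₁ (p , q)) → inj₂ (q , p) ; (inj₂ (p , q)) → inj₁ (q , p) }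
  ; from-≺ = λ { (inj₁ (p , q)) → inj₂ (q , p) ; (inj₂ (p , q)) → inj₁ (q , p) } }

*-cong : ∀ {A A′ B B′} → A ≃ A′ → B ≃ B′ → A * B ≃ A′ * B′
*-cong φ ψ = record
  { to = λ (x , y) → φ.to x , ψ.to y ; from = λ (x , y) → φ.from x , ψ.from y
  ; to-from = λ (x , y) → cong₂ _,_ (φ.to-from x) (ψ.to-from y)
  ; from-to = λ (x , y) → cong₂ _,_ (φ.from-to x) (ψ.from-to y)
  ; to-≺ = λ { (inj₁ (p , q)) → inj₁ (φ.to-≼ p , ψ.to-≺ q) ; (inj₂ (p , q)) → inj₂ (φ.to-≺ p , ψ.to-≼ q) }
  ; from-≺ = λ { (inj₁ (p , q)) → inj₁ (φ.from-≼ p , ψ.from-≺ q) ; (inj₂ (p , q)) → inj₂ (φ.from-≺ p , ψ.from-≼ q) } }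
  where
  module φ = _≃_ φ
  module ψ = _≃_ ψ

*-assoc : ∀ A B C → (A * B) * C ≃ A * (B * C)
*-assoc A B C = record
  { to = λ ((x , y) , z) → x , (y , z) ; from = λ (x , (y , z)) → (x , y) , z
  ; to-from = λ _ → refl ; from-to = λ _ → refl
  ; to-≺ = λ { (inj₁ (p , q)) → inj₁ (proj₁ (*-≼⁻¹ A B p) , inj₁ (proj₂ (*-≼⁻¹ A B p) , q))
             ; (inj₂ (inj₁ (p , q) , r)) → inj₁ (p , inj₂ (q , r))
             ; (inj₂ (inj₂ (p , q) , r)) → inj₂ (p , *-≼ B C q r) }
  ; from-≺ = λ { (inj₁ (p , inj₁ (q , r))) → inj₁ (*-≼ A B p q , r)
               ; (inj₁ (p , inj₂ (q , r))) → inj₂ (inj₁ (p , q) , r)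
               ; (inj₂ (p , q)) → inj₂ (inj₂ (p , proj₁ (*-≼⁻¹ B C q)) , proj₂ (*-≼⁻¹ B C q)) } }

-- The only proper subset of a one-element set is empty, so the second coordinate carries no
-- information.
*-identityʳ : ∀ M → M * Sphere 0 ≃ M
*-identityʳ M = record
  { to = proj₁
  ; from = λ x → x , (outside ∷ [] , tt)
  ; to-from = λ _ → refl
  ; from-to = λ { (x , outside ∷ [] , tt) → refl }
  ; to-≺ = λ { (inj₂ (p , _)) → p ; {_ , outside ∷ [] , tt} {_ , outside ∷ [] , tt} (inj₁ (_ , _ , i , i∈s , i∉s)) → ⊥-elim (i∉s i∈s) }
  ; from-≺ = λ p → inj₂ (p , inj₁ refl) }

*-facet⁻¹ : ∀ A B {f g} → IsFacet (A * B) (f , g) → IsFacet A f × IsFacet B g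
*-facet⁻¹ A B fac =
  facet-intro A (λ f′ p → facet-elim (A * B) fac (f′ , _) (inj₂ (p , inj₁ refl))) ,
  facet-intro B (λ g′ p → facet-elim (A * B) fac (_ , g′) (inj₁ (inj₁ refl , p)))

*-facet : ∀ A B {f g} → IsFacet A f → IsFacet B g → IsFacet (A * B) (f , g)
*-facet A B facf facg = facet-intro (A * B) λ { (f′ , g′) (inj₁ (_ , p)) → facet-elim B facg g′ p ; (f′ , g′) (inj₂ (p , _)) → facet-elim A facf f′ p }

*-bottom⁻¹ : ∀ A B {b c} → Bottom (A * B) (b , c) → Bottom A b × Bottom B c
*-bottom⁻¹ A B {b} {c} bot = (λ x → proj₁ (*-≼⁻¹ A B (bot (x , c)))) , (λ y → proj₂ (*-≼⁻¹ A B (bot (b , y))))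

*-bottom : ∀ A B {b c} → Bottom A b → Bottom B c → Bottom (A * B) (b , c)
*-bottom A B p q (x , y) = *-≼ A B (p x) (q y)

-- A is the interval above (𝟎, g) for any facet g of B.
*-pseudomanifold⁻¹ˡ : ∀ A B → Face (A * B) → IsCellularPseudomanifold (A * B) → IsCellularPseudomanifold A
*-pseudomanifold⁻¹ˡ A B x₀ cp = UpperSet.pseudomanifold A (A * B) (record
  { e = λ x → x , g
  ; injective = λ { refl → refl }
  ; mono = λ p → inj₂ (p , inj₁ refl)
  ; reflects = λ { (inj₁ (_ , p)) → ⊥-elim (facet-elim B facg g p) ; (inj₂ (p , _)) → p }
  ; upper = λ { _ (inj₁ (_ , p)) → ⊥-elim (facet-elim B facg _ p)
              ; _ (inj₂ (_ , inj₂ p)) → ⊥-elim (facet-elim B facg _ p)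
              ; _ {y , _} (inj₂ (_ , inj₁ refl)) → y , refl }
  ; least = proj₁ bot
  ; least-bottom = proj₁ (*-bottom⁻¹ A B bot-bottom) }) cp
  where
  open Pseudomanifold (A * B) cp x₀
  g = proj₂ (proj₁ (facet-above x₀))
  facg = proj₂ (*-facet⁻¹ A B (proj₁ (proj₂ (facet-above x₀))))

*-pseudomanifold⁻¹ʳ : ∀ A B → Face (A * B) → IsCellularPseudomanifold (A * B) → IsCellularPseudomanifold B
*-pseudomanifold⁻¹ʳ A B x₀ cp = *-pseudomanifold⁻¹ˡ B A (_≃_.to (*-comm A B) x₀) (≃-pseudomanifold (*-comm A B) x₀ cp)

-- Standard spheres and their symmetries

proper-intro : ∀ {n} (s : Subset n) {i} → i ∉ s → T (not (full? s))
proper-intro (outside ∷ s) i∉s = tt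
proper-intro (inside ∷ s) {zero} i∉s = ⊥-elim (i∉s here)
proper-intro (inside ∷ s) {suc i} i∉s = proper-intro s (i∉s ∘ there)

proper-elim : ∀ {n} (s : Subset n) → T (not (full? s)) → ∃ λ i → i ∉ s
proper-elim (outside ∷ s) _ = zero , λ ()
proper-elim (inside ∷ s) p with proper-elim s p
... | i , i∉s = suc i , i∉s ∘ drop-there

module _ (m : ℕ) where

  private
    S = Sphere m

  Sphere-≡ : {x y : Face S} → proj₁ x ≡ proj₁ y → x ≡ y
  Sphere-≡ {s , p} {s , q} refl = cong (s ,_) (T-irrelevant p q)

  Sphere-ext : {x y : Face S} → proj₁ x ⊆ proj₁ y → proj₁ y ⊆ proj₁ x → x ≡ y
  Sphere-ext p q = Sphere-≡ (⊆-antisym p q)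

  ⊆⇒≼ : {x y : Face S} → proj₁ x ⊆ proj₁ y → x ≼[ S ] y
  ⊆⇒≼ {x} {y} x⊆y with any? (λ i → (i ∈? proj₁ y) ×-dec ¬? (i ∈? proj₁ x))
  ... | yes p = inj₂ (x⊆y , p)
  ... | no none = inj₁ (cong face (Sphere-ext x⊆y λ {i} i∈y → decidable-stable (i ∈? proj₁ x) λ i∉x → none (i , i∈y , i∉x)))

  ≼⇒⊆ : {x y : Face S} → x ≼[ S ] y → proj₁ x ⊆ proj₁ y
  ≼⇒⊆ (inj₁ refl) = id
  ≼⇒⊆ (inj₂ p) = proj₁ p

  ∅ : Face S
  ∅ = Subset.⊥ , tt

  ∅-bottom : Bottom S ∅
  ∅-bottom x = ⊆⇒≼ {∅} {x} λ i∈⊥ → ⊥-elim (∉⊥ i∈⊥)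

  -- The second point `j` witnesses that `⁅ i ⁆` is proper. There is none in `Sphere 0`, which
  -- accordingly has no vertices.
  singleton : ∀ i {j} → j ≢ i → Face S
  singleton i j≢i = ⁅ i ⁆ , proper-intro ⁅ i ⁆ (j≢i ∘ x∈⁅y⁆⇒x≡y i)

  singleton-vertex : ∀ i {j} (j≢i : j ≢ i) → IsVertex S (singleton i j≢i)
  singleton-vertex i j≢i = vertex-intro S {∅} {singleton i j≢i} ∅-bottom ((λ i∈⊥ → ⊥-elim (∉⊥ i∈⊥)) , i , x∈⁅x⁆ i , ∉⊥) between
    where
    between : ∀ z → ∅ ≺[ S ] z → ¬ (z ≺[ S ] singleton i j≢i)
    between z (_ , k , k∈z , _) (z⊆i , l , l∈i , l∉z)
      with x∈⁅y⁆⇒x≡y i (z⊆i k∈z) | x∈⁅y⁆⇒x≡y i l∈i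
    ... | refl | refl = l∉z k∈z

  -- Any point `i` of `x` outside the bottom gives a singleton below `x`, proper because `x` is;
  -- were it different from `x`, it would lie strictly between the bottom and `x`.
  vertex-singleton : ∀ x → IsVertex S x → ∃ λ i → proj₁ x ≡ ⁅ i ⁆
  vertex-singleton x vx with vertex-elim S vx
  ... | b , b-bot , (_ , i , i∈x , i∉b) , cover with proper-elim (proj₁ x) (proj₂ x)
  ... | j , j∉x = i , equal (⊆⇒≼ {single} {x} single⊆x)
    where
    single = singleton i {j} λ { refl → j∉x i∈x }
    single⊆x : ⁅ i ⁆ ⊆ proj₁ x
    single⊆x k∈i with x∈⁅y⁆⇒x≡y i k∈i
    ... | refl = i∈x
    equal : single ≼[ S ] x → proj₁ x ≡ ⁅ i ⁆
    equal (inj₁ e) = cong proj₁ (sym (face-injective e))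
    equal (inj₂ lt) = ⊥-elim (cover single ((λ k∈b → ⊥-elim (∉⊥ (≼⇒⊆ {b} {∅} (b-bot ∅) k∈b))) , i , x∈⁅x⁆ i , i∉b) lt)

module _ {n : ℕ} (i j : Fin n) where

  exchange : Fin n → Fin n
  exchange k with k ≟F i | k ≟F j
  ... | yes _ | _ = j
  ... | no _ | yes _ = i
  ... | no _ | no _ = k

  exchange-i : exchange i ≡ j
  exchange-i with i ≟F i | i ≟F j
  ... | yes _ | _ = refl
  ... | no i≢i | _ = ⊥-elim (i≢i refl)

  exchange-j : exchange j ≡ i
  exchange-j with j ≟F i | j ≟F j
  ... | yes p | _ = p
  ... | no _ | yes _ = refl
  ... | no _ | no j≢j = ⊥-elim (j≢j refl)

  exchange-other : ∀ {k} → k ≢ i → k ≢ j → exchange k ≡ k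
  exchange-other {k} k≢i k≢j with k ≟F i | k ≟F j
  ... | yes p | _ = ⊥-elim (k≢i p)
  ... | no _ | yes p = ⊥-elim (k≢j p)
  ... | no _ | no _ = refl

  exchange-involutive : ∀ k → exchange (exchange k) ≡ k
  exchange-involutive k = go (k ≟F i) (k ≟F j)
    where
    go : Dec (k ≡ i) → Dec (k ≡ j) → exchange (exchange k) ≡ k
    go (yes refl) _ = trans (cong exchange exchange-i) exchange-j
    go (no _) (yes refl) = trans (cong exchange exchange-j) exchange-i
    go (no k≢i) (no k≢j) = trans (cong exchange (exchange-other k≢i k≢j)) (exchange-other k≢i k≢j)

module _ (m : ℕ) (i j : Fin (suc m)) where

  private
    S = Sphere m
    π = exchange i j

  -- This is the preimage under `π`. As `π` is an involution it is also the image, and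
  -- `permute-face` is its own inverse.
  permute : Subset (suc m) → Subset (suc m)
  permute s = tabulate (lookup s ∘ π)

  permute-∈ : ∀ s {k} → π k ∈ s → k ∈ permute s
  permute-∈ s {k} p = lookup⇒[]= k _ (trans (lookup∘tabulate (lookup s ∘ π) k) ([]=⇒lookup p))

  permute-∈⁻¹ : ∀ s {k} → k ∈ permute s → π k ∈ s
  permute-∈⁻¹ s {k} p = lookup⇒[]= (π k) s (trans (sym (lookup∘tabulate (lookup s ∘ π) k)) ([]=⇒lookup p))

  π-∈ : ∀ s {k} → k ∈ s → π k ∈ permute s
  π-∈ s {k} p = permute-∈ s (subst (_∈ s) (sym (exchange-involutive i j k)) p)

  permute-proper : ∀ s → T (not (full? s)) → T (not (full? (permute s)))
  permute-proper s p with proper-elim s p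
  ... | k , k∉s = proper-intro (permute s) λ q → k∉s (subst (_∈ s) (exchange-involutive i j k) (permute-∈⁻¹ s {π k} q))

  permute-face : Face S → Face S
  permute-face (s , p) = permute s , permute-proper s p

  permute-involutive : ∀ x → permute-face (permute-face x) ≡ x
  permute-involutive x@(s , _) = Sphere-ext m
    (λ {k} q → subst (_∈ s) (exchange-involutive i j k) (permute-∈⁻¹ s (permute-∈⁻¹ (permute s) q)))
    (λ {k} q → permute-∈ (permute s) (permute-∈ s (subst (_∈ s) (sym (exchange-involutive i j k)) q)))

  permute-⊂ : ∀ {s t} → s ⊂ t → permute s ⊂ permute t
  permute-⊂ {s} {t} (s⊆t , k , k∈t , k∉s) = (λ q → permute-∈ t (s⊆t (permute-∈⁻¹ s q))) , π k , π-∈ t k∈t ,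
    λ q → k∉s (subst (_∈ s) (exchange-involutive i j k) (permute-∈⁻¹ s q))

  permutation : S ≃ S
  permutation = record
    { to = permute-face ; from = permute-face ; to-from = permute-involutive ; from-to = permute-involutive
    ; to-≺ = permute-⊂ ; from-≺ = permute-⊂ }

  permute-singleton : ∀ k → permute ⁅ k ⁆ ≡ ⁅ π k ⁆
  permute-singleton k = ⊆-antisym there′ back
    where
    there′ : permute ⁅ k ⁆ ⊆ ⁅ π k ⁆
    there′ {l} q = subst (_∈ ⁅ π k ⁆) (trans (cong π (sym (x∈⁅y⁆⇒x≡y k (permute-∈⁻¹ ⁅ k ⁆ q)))) (exchange-involutive i j l)) (x∈⁅x⁆ (π k))
    back : ⁅ π k ⁆ ⊆ permute ⁅ k ⁆
    back {l} q = subst (_∈ permute ⁅ k ⁆) (sym (x∈⁅y⁆⇒x≡y (π k) q)) (π-∈ ⁅ k ⁆ (x∈⁅x⁆ k))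

  permutation-swap : ∀ {x y} → proj₁ x ≡ ⁅ i ⁆ → proj₁ y ≡ ⁅ j ⁆ → Swap S x y
  permutation-swap {x} {y} refl refl = permutation ,
    Sphere-≡ m (trans (permute-singleton i) (cong ⁅_⁆ (exchange-i i j))) ,
    Sphere-≡ m (trans (permute-singleton j) (cong ⁅_⁆ (exchange-j i j))) ,
    fixes
    where
    fixes : ∀ v → IsVertex S v → v ≢ x → v ≢ y → permute-face v ≡ v
    fixes v vv v≢x v≢y with vertex-singleton m v vv
    ... | k , refl = Sphere-≡ m (trans (permute-singleton k) (cong ⁅_⁆ (exchange-other i j
      (λ { refl → v≢x (Sphere-≡ m refl) }) (λ { refl → v≢y (Sphere-≡ m refl) }))))

-- Reducible classes in spheres and joins

-- The trace that complete reducibility leaves on the classes; unlike a list of spheres it is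
-- visible inside any join, and uniqueness rests on it.
AllReducible : FacePoset → Set
AllReducible M = ∀ v → IsVertex M v → ReducibleAt M v

-- Permutations of the ground set make all singletons similar, and a proper subset always omits one
-- of them.
Sphere-AllReducible : ∀ m → AllReducible (Sphere m)
Sphere-AllReducible m x vx (s , p) _ h with proper-elim s p | vertex-singleton m x vx
... | i , i∉s | j , x≡j with j ≟F i
... | yes refl = i∉s (≼⇒⊆ m {x} {s , p} (h x vx (inj₁ refl)) (subst (i ∈_) (sym x≡j) (x∈⁅x⁆ i)))
... | no j≢i = i∉s (≼⇒⊆ m {y} {s , p} (h y (singleton-vertex m i j≢i) (inj₂ (permutation-swap m j i {x} {y} x≡j refl))) (x∈⁅x⁆ i))
  where y = singleton m i j≢i

≃-AllReducible : ∀ {M N} → M ≃ N → AllReducible M → AllReducible N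
≃-AllReducible {N = N} φ all v vv = subst (ReducibleAt N) (to-from v) (≃-ReducibleAt φ (all (from v) (≃-vertex (≃-sym φ) vv)))
  where open _≃_ φ

-- If both coordinates were above their bottoms, `(x , c)` would lie strictly between `(b , c)` and
-- `(x , y)`.
*-vertex⁻¹ : ∀ A B {x y} → IsVertex (A * B) (x , y) → (IsVertex A x × Bottom B y) ⊎ (Bottom A x × IsVertex B y)
*-vertex⁻¹ A B {x} {y} v with vertex-elim (A * B) v
... | (b , c) , bot , inj₁ (inj₂ b<x , c<y) , cover = ⊥-elim (cover (x , c) (inj₂ (b<x , inj₁ refl)) (inj₁ (inj₁ refl , c<y)))
... | (b , c) , bot , inj₂ (b<x , inj₂ c<y) , cover = ⊥-elim (cover (x , c) (inj₂ (b<x , inj₁ refl)) (inj₁ (inj₁ refl , c<y)))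
... | (b , c) , bot , inj₁ (inj₁ refl , c<y) , cover = inj₂ (proj₁ (*-bottom⁻¹ A B bot) ,
  vertex-intro B (proj₂ (*-bottom⁻¹ A B bot)) c<y λ z p q → cover (x , z) (inj₁ (inj₁ refl , p)) (inj₁ (inj₁ refl , q)))
... | (b , c) , bot , inj₂ (b<x , inj₁ refl) , cover = inj₁ (
  vertex-intro A (proj₁ (*-bottom⁻¹ A B bot)) b<x (λ z p q → cover (z , y) (inj₂ (p , inj₁ refl)) (inj₂ (q , inj₁ refl))) ,
  proj₂ (*-bottom⁻¹ A B bot))

module Join (A B : FacePoset) (cpA : IsCellularPseudomanifold A) (cpB : IsCellularPseudomanifold B) (a₀ : Face A) (b₀ : Face B) where

  module A = Pseudomanifold A cpA a₀
  module B = Pseudomanifold B cpB b₀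

  vertexˡ : ∀ {v} → IsVertex A v → IsVertex (A * B) (v , B.bot)
  vertexˡ {v} vv = vertex-intro (A * B) (*-bottom A B A.bot-bottom B.bot-bottom)
    (inj₂ (proj₁ (A.vertex⇒covers-bot vv) , inj₁ refl)) between
    where
    between : ∀ z → (A.bot , B.bot) ≺[ A * B ] z → ¬ (z ≺[ A * B ] (v , B.bot))
    between (z , w) (inj₂ (p , _)) (inj₂ (q , _)) = proj₂ (A.vertex⇒covers-bot vv) (face z) p q
    between (z , w) (inj₁ (_ , p)) q = B.⊏-irrefl (face B.bot)
      (B.⊏-⊑-trans (face B.bot) {face w} p (proj₂ (*-≼⁻¹ A B {z} {v} {w} (inj₂ q))))
    between (z , w) (inj₂ _) (inj₁ (_ , q)) = B.⊏-irrefl (face B.bot)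
      (B.⊑-⊏-trans {y = face w} (face B.bot) (B.bot-bottom w) q)

  vertex-cases : ∀ {x y} → IsVertex (A * B) (x , y) → (IsVertex A x × y ≡ B.bot) ⊎ (x ≡ A.bot × IsVertex B y)
  vertex-cases v with *-vertex⁻¹ A B v
  ... | inj₁ (p , q) = inj₁ (p , B.bottom-unique q)
  ... | inj₂ (p , q) = inj₂ (A.bottom-unique p , q)

  Similarˡ : ∀ {u v} → Similar A u v → Similar (A * B) (u , B.bot) (v , B.bot)
  Similarˡ (inj₁ refl) = inj₁ refl
  Similarˡ {u} {v} (inj₂ (φ , p , q , fix)) = inj₂ (*-cong φ ≃-refl , cong (_, B.bot) p , cong (_, B.bot) q , fixes)
    where
    fixes : ∀ w → IsVertex (A * B) w → w ≢ (u , B.bot) → w ≢ (v , B.bot) → (_≃_.to φ (proj₁ w) , proj₂ w) ≡ w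
    fixes (x , y) vw w≢u w≢v with vertex-cases vw
    ... | inj₁ (vx , refl) = cong (_, y) (fix x vx (λ { refl → w≢u refl }) (λ { refl → w≢v refl }))
    -- A vertex of `B` has the bottom of `A` as first coordinate, and automorphisms fix the bottom.
    ... | inj₂ (refl , _) = cong (_, y) (A.bottom-unique (≃-bottom φ A.bot-bottom))

  ReducibleAtˡ : ∀ {v} → ReducibleAt A v → ReducibleAt (A * B) (v , B.bot)
  ReducibleAtˡ red (f , g) fac h = red f (proj₁ (*-facet⁻¹ A B fac)) λ y vy s →
    proj₁ (*-≼⁻¹ A B (h (y , B.bot) (vertexˡ vy) (Similarˡ s)))

module Joinʳ (A B : FacePoset) (cpA : IsCellularPseudomanifold A) (cpB : IsCellularPseudomanifold B) (a₀ : Face A) (b₀ : Face B) where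

  open Join A B cpA cpB a₀ b₀ using (module A; module B)
  module BA = Join B A cpB cpA b₀ a₀

  vertexʳ : ∀ {w} → IsVertex B w → IsVertex (A * B) (A.bot , w)
  vertexʳ vw = ≃-vertex (*-comm B A) (BA.vertexˡ vw)

  ReducibleAtʳ : ∀ {w} → ReducibleAt B w → ReducibleAt (A * B) (A.bot , w)
  ReducibleAtʳ red = ≃-ReducibleAt (*-comm B A) (BA.ReducibleAtˡ red)

*-AllReducible : ∀ A B → IsCellularPseudomanifold A → IsCellularPseudomanifold B → Face A → Face B →
  AllReducible A → AllReducible B → AllReducible (A * B)
*-AllReducible A B cpA cpB a₀ b₀ allA allB (x , y) v with Join.vertex-cases A B cpA cpB a₀ b₀ v
... | inj₁ (vx , refl) = Join.ReducibleAtˡ A B cpA cpB a₀ b₀ (allA x vx)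
... | inj₂ (refl , vy) = Joinʳ.ReducibleAtʳ A B cpA cpB a₀ b₀ (allB y vy)

-- `*-AllReducible` asks for pseudomanifolds, and the factors inherit this from the whole join; so
-- the hypothesis accompanies the recursion.
joinSpheres-AllReducible : ∀ m ms → IsCellularPseudomanifold (joinSpheres m ms) → Face (joinSpheres m ms) →
  AllReducible (joinSpheres m ms)
joinSpheres-AllReducible m [] _ _ = Sphere-AllReducible m
joinSpheres-AllReducible m (m′ ∷ ms) cp x₀ = *-AllReducible (Sphere m) J
  (*-pseudomanifold⁻¹ˡ (Sphere m) J x₀ cp) cpJ (proj₁ x₀) (proj₂ x₀)
  (Sphere-AllReducible m) (joinSpheres-AllReducible m′ ms cpJ (proj₂ x₀))
  where
  J = joinSpheres m′ ms
  cpJ = *-pseudomanifold⁻¹ʳ (Sphere m) J x₀ cp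

CompletelyReducible⇒AllReducible : ∀ C → IsCellularPseudomanifold C → Face C → CompletelyReducible C → AllReducible C
CompletelyReducible⇒AllReducible C cp c₀ (m , ms , iso) = ≃-AllReducible (≃-sym φ)
  (joinSpheres-AllReducible m ms (≃-pseudomanifold φ c₀ cp) (_≃_.to φ c₀))
  where φ = ≅⇒≃ {C} {joinSpheres m ms} iso

-- Restricting isomorphisms of joins, and uniqueness

module Restriction
  (A B : FacePoset) (cpA : IsCellularPseudomanifold A) (cpB : IsCellularPseudomanifold B) (a₀ : Face A) (b₀ : Face B)
  (A′ B′ : FacePoset) (cpA′ : IsCellularPseudomanifold A′) (cpB′ : IsCellularPseudomanifold B′) (a₀′ : Face A′) (b₀′ : Face B′)
  where

  open Join A B cpA cpB a₀ b₀ using (module A; module B; vertex-cases)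
  module J′ = Join A′ B′ cpA′ cpB′ a₀′ b₀′
  open J′ using () renaming (module A to A′; module B to B′)

  -- What `ψ` needs in order to send the slice of `A * B` over `B.bot`, a copy of `A`, into the
  -- slice over `B′.bot`.
  Separates : A * B ≃ A′ * B′ → Set
  Separates ψ = ∀ w v → IsVertex B′ w → IsVertex A v → _≃_.from ψ (A′.bot , w) ≢ (v , B.bot)

  -- A vertex of `B′` below the second coordinate pulls back to a vertex below `(x , B.bot)`. That
  -- one belongs to `A`, which `sep` forbids.
  second-bot : (ψ : A * B ≃ A′ * B′) → Separates ψ → ∀ x → proj₂ (_≃_.to ψ (x , B.bot)) ≡ B′.bot
  second-bot ψ sep x = B′.no-vertex⇒bot λ w vw w≼ → absurd w vw (subst (Le (A * B) _) (from-to (x , B.bot))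
      (from-≼ (*-≼ A′ B′ (A′.bot-bottom _) w≼)))
    where
    open _≃_ ψ
    absurd : ∀ w → IsVertex B′ w → ¬ (from (A′.bot , w) ≼[ A * B ] (x , B.bot))
    absurd w vw le with vertex-cases (≃-vertex (≃-sym ψ) (Joinʳ.vertexʳ A′ B′ cpA′ cpB′ a₀′ b₀′ vw))
    ... | inj₁ (v , e) = sep w _ vw v (cong (proj₁ (from (A′.bot , w)) ,_) e)
    ... | inj₂ (_ , v) = B.vertex≢bot v (B.≼-antisym (proj₂ (*-≼⁻¹ A B le)) (B.bot-bottom _))

  first-≺ : ∀ {x y z w} → (x , z) ≺[ A′ * B′ ] (y , w) → z ≡ B′.bot → w ≡ B′.bot → x ≺[ A′ ] y
  first-≺ (inj₁ (_ , p)) refl refl = ⊥-elim (B′.⊏-irrefl (face B′.bot) p)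
  first-≺ (inj₂ (p , _)) _ _ = p

module Restrict
  (A B : FacePoset) (cpA : IsCellularPseudomanifold A) (cpB : IsCellularPseudomanifold B) (a₀ : Face A) (b₀ : Face B)
  (A′ B′ : FacePoset) (cpA′ : IsCellularPseudomanifold A′) (cpB′ : IsCellularPseudomanifold B′) (a₀′ : Face A′) (b₀′ : Face B′)
  where

  module R = Restriction A B cpA cpB a₀ b₀ A′ B′ cpA′ cpB′ a₀′ b₀′
  module R′ = Restriction A′ B′ cpA′ cpB′ a₀′ b₀′ A B cpA cpB a₀ b₀
  open Join A B cpA cpB a₀ b₀ using (module B)
  open Join A′ B′ cpA′ cpB′ a₀′ b₀′ using () renaming (module B to B′)

  restrict : (ψ : A * B ≃ A′ * B′) → R.Separates ψ → R′.Separates (≃-sym ψ) → A ≃ A′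
  restrict ψ sep sep′ = record
    { to = λ x → proj₁ (ψ.to (x , B.bot))
    ; from = λ x → proj₁ (ψ.from (x , B′.bot))
    ; to-from = λ y → cong proj₁ (trans (cong ψ.to (from-bot y)) (ψ.to-from _))
    ; from-to = λ x → cong proj₁ (trans (cong ψ.from (to-bot x)) (ψ.from-to _))
    ; to-≺ = λ {x} {y} p → R.first-≺ (ψ.to-≺ (inj₂ (p , inj₁ refl))) (R.second-bot ψ sep x) (R.second-bot ψ sep y)
    ; from-≺ = λ {x} {y} p → R′.first-≺ (ψ.from-≺ (inj₂ (p , inj₁ refl))) (R′.second-bot (≃-sym ψ) sep′ x) (R′.second-bot (≃-sym ψ) sep′ y) }
    where
    module ψ = _≃_ ψ
    to-bot : ∀ x → (proj₁ (ψ.to (x , B.bot)) , B′.bot) ≡ ψ.to (x , B.bot)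
    to-bot x = cong (proj₁ (ψ.to (x , B.bot)) ,_) (sym (R.second-bot ψ sep x))
    from-bot : ∀ y → (proj₁ (ψ.from (y , B′.bot)) , B.bot) ≡ ψ.from (y , B′.bot)
    from-bot y = cong (proj₁ (ψ.from (y , B′.bot)) ,_) (sym (R′.second-bot (≃-sym ψ) sep′ y))

module JoinReducible (A B : FacePoset) (cpA : IsCellularPseudomanifold A) (cpB : IsCellularPseudomanifold B)
  (cp : IsCellularPseudomanifold (A * B)) (a₀ : Face A) (b₀ : Face B) where

  open Join A B cpA cpB a₀ b₀
  open Joinʳ A B cpA cpB a₀ b₀ using (vertexʳ)
  open Restrict A B cpA cpB a₀ b₀ A B cpA cpB a₀ b₀ using (restrict)

  -- The transposition of two vertices of `A` fixes each vertex of `B`, so it mixes no vertices of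
  -- the two factors and restricts to `A`.
  Similarˡ⁻¹ : ∀ {u v} → IsVertex A u → IsVertex A v → Similar (A * B) (u , B.bot) (v , B.bot) → Similar A u v
  Similarˡ⁻¹ _ _ (inj₁ refl) = inj₁ refl
  Similarˡ⁻¹ {u} {v} vu vv (inj₂ (φ , p , q , fix)) = inj₂ (restrict φ
      (λ w x vw vx e → A.vertex≢bot vx (cong proj₁ (trans (sym e) (trans (cong φ.from (sym (fixʳ vw))) (φ.from-to _)))))
      (λ w x vw vx e → A.vertex≢bot vx (cong proj₁ (trans (sym e) (fixʳ vw)))) ,
    cong proj₁ p , cong proj₁ q ,
    λ w vw w≢u w≢v → cong proj₁ (fix (w , B.bot) (vertexˡ vw) (λ { refl → w≢u refl }) (λ { refl → w≢v refl })))
    where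
    module φ = _≃_ φ
    fixʳ : ∀ {w} → IsVertex B w → φ.to (A.bot , w) ≡ (A.bot , w)
    fixʳ vw = fix _ (vertexʳ vw) (λ { refl → A.vertex≢bot vu refl }) (λ { refl → A.vertex≢bot vv refl })

  -- A reducible class meeting both factors would be missed twice by some facet.
  ReducibleAtˡ⁻¹ : ∀ {v} → IsVertex A v → ReducibleAt (A * B) (v , B.bot) → ReducibleAt A v
  ReducibleAtˡ⁻¹ {v} vv red f facf h with B.facet-above b₀
  ... | g , facg , _ = red (f , g) (*-facet A B facf facg) λ y vy s → below y vy s (vertex-cases vy)
    where
    open ReducibleClass (A * B) cp (a₀ , b₀)
    below : ∀ y → IsVertex (A * B) y → Similar (A * B) (v , B.bot) y →
      (IsVertex A (proj₁ y) × proj₂ y ≡ B.bot) ⊎ (proj₁ y ≡ A.bot × IsVertex B (proj₂ y)) → y ≼[ A * B ] (f , g)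
    below (u , _) vy s (inj₁ (vu , refl)) = *-≼ A B (h u vu (Similarˡ⁻¹ vv vu s)) (B.bot-bottom g)
    below (_ , w) vy s (inj₂ (refl , vw)) with A.facet-avoiding-vertex vv | B.facet-avoiding-vertex vw
    ... | f′ , facf′ , v⋠f′ | g′ , facg′ , w⋠g′ = ⊥-elim (w⋠g′ (proj₂ (*-≼⁻¹ A B
      (Class.facet-hits (vertexˡ vv) red (*-facet A B facf′ facg′) (vertexˡ vv) vy (inj₁ refl) s
        (λ { refl → A.vertex≢bot vv refl }) (λ p → v⋠f′ (proj₁ (*-≼⁻¹ A B p)))))))

module Uniqueness
  (I C : FacePoset) (cpI : IsCellularPseudomanifold I) (cpC : IsCellularPseudomanifold C) (i₀ : Face I) (c₀ : Face C)
  (I′ C′ : FacePoset) (cpI′ : IsCellularPseudomanifold I′) (cpC′ : IsCellularPseudomanifold C′) (i₀′ : Face I′) (c₀′ : Face C′)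
  (cp : IsCellularPseudomanifold (I * C)) (irr : Irreducible I) (all : AllReducible C′)
  (ψ : I * C ≃ I′ * C′) where

  -- Reducibility at a vertex of `C′` persists in the join and passes through `ψ`. Were the vertex
  -- to land in `I`, it would descend to `I` and contradict irreducibility.
  separates : Restriction.Separates I C cpI cpC i₀ c₀ I′ C′ cpI′ cpC′ i₀′ c₀′ ψ
  separates w v vw vv e = irr (ReducibleAt⇒Reducible I vv (JoinReducible.ReducibleAtˡ⁻¹ I C cpI cpC cp i₀ c₀ vv
    (subst (ReducibleAt (I * C)) e (≃-ReducibleAt (≃-sym ψ) (Joinʳ.ReducibleAtʳ I′ C′ cpI′ cpC′ i₀′ c₀′ (all w vw))))))

factors-unique : ∀ I C I′ C′ →
  IsCellularPseudomanifold I → IsCellularPseudomanifold C → IsCellularPseudomanifold I′ → IsCellularPseudomanifold C′ →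
  Irreducible I → AllReducible C → Irreducible I′ → AllReducible C′ →
  IsCellularPseudomanifold (I * C) → Face (I * C) → I * C ≃ I′ * C′ → (I ≃ I′) × (C ≃ C′)
factors-unique I C I′ C′ cpI cpC cpI′ cpC′ irrI allC irrI′ allC′ cp x₀ ψ =
  Restrict.restrict I C cpI cpC (proj₁ x₀) (proj₂ x₀) I′ C′ cpI′ cpC′ (proj₁ x₀′) (proj₂ x₀′) ψ sep sep′ ,
  -- Commuting both joins makes `C` the first factor. The condition now says that no vertex of `I′`
  -- comes from one of `C`, which is `sep′` read through the inverse of `ψ`.
  Restrict.restrict C I cpC cpI (proj₂ x₀) (proj₁ x₀) C′ I′ cpC′ cpI′ (proj₂ x₀′) (proj₁ x₀′)
    (≃-trans (*-comm C I) (≃-trans ψ (*-comm I′ C′)))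
    (λ w v vw vv e → sep′ v w vv vw (trans (cong (_≃_.to ψ) (sym (swapped e))) (_≃_.to-from ψ _)))
    (λ w v vw vv e → sep v w vv vw (trans (cong (_≃_.from ψ) (sym (swapped e))) (_≃_.from-to ψ _)))
  where
  x₀′ = _≃_.to ψ x₀
  cp′ = ≃-pseudomanifold ψ x₀ cp
  sep = Uniqueness.separates I C cpI cpC (proj₁ x₀) (proj₂ x₀) I′ C′ cpI′ cpC′ (proj₁ x₀′) (proj₂ x₀′) cp irrI allC′ ψ
  sep′ = Uniqueness.separates I′ C′ cpI′ cpC′ (proj₁ x₀′) (proj₂ x₀′) I C cpI cpC (proj₁ x₀) (proj₂ x₀) cp′ irrI′ allC (≃-sym ψ)
  swapped : {X Y : Set} {p : X × Y} {y : Y} {x : X} → (proj₂ p , proj₁ p) ≡ (y , x) → p ≡ (x , y)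
  swapped refl = refl

-- Deciding reducibility

module Decide (M : FacePoset) (cp : IsCellularPseudomanifold M) (x₀ : Face M) where

  open Pseudomanifold M cp x₀

  -- A swap unfolded into a map and its inverse, so that each clause is a decidable statement about
  -- finitely many faces.
  IsSwap : Face M → Face M → (Face M → Face M) → (Face M → Face M) → Set
  IsSwap x y f g =
    (∀ a → f (g a) ≡ a) × (∀ a → g (f a) ≡ a) ×
    (∀ a b → a ≺[ M ] b → f a ≺[ M ] f b) × (∀ a b → a ≺[ M ] b → g a ≺[ M ] g b) ×
    f x ≡ y × f y ≡ x × (∀ v → Vertex v → v ≢ x → v ≢ y → f v ≡ v)

  IsSwap-resp : ∀ {x y f f′ g g′} → (∀ a → f a ≡ f′ a) → (∀ a → g a ≡ g′ a) → IsSwap x y f g → IsSwap x y f′ g′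
  IsSwap-resp {x} {y} {f} {f′} {g} {g′} p q (fg , gf , f≺ , g≺ , fx , fy , fix) =
    (λ a → trans (sym (p _)) (trans (cong f (sym (q a))) (fg a))) ,
    (λ a → trans (sym (q _)) (trans (cong g (sym (p a))) (gf a))) ,
    (λ a b lt → subst₂ (Lt M) (p a) (p b) (f≺ a b lt)) ,
    (λ a b lt → subst₂ (Lt M) (q a) (q b) (g≺ a b lt)) ,
    trans (sym (p x)) fx , trans (sym (p y)) fy ,
    λ v vv v≢x v≢y → trans (sym (p v)) (fix v vv v≢x v≢y)

  isSwap? : ∀ x y f g → Dec (IsSwap x y f g)
  isSwap? x y f g =
    forall-face? (λ a → f (g a) ≟ᶠ a) ×-dec forall-face? (λ a → g (f a) ≟ᶠ a) ×-dec
    monotone? f ×-dec monotone? g ×-dec (f x ≟ᶠ y) ×-dec (f y ≟ᶠ x) ×-dec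
    forall-face? (λ v → vertex? v →-dec (¬? (v ≟ᶠ x) →-dec (¬? (v ≟ᶠ y) →-dec (f v ≟ᶠ v))))
    where
    monotone? : ∀ h → Dec (∀ a b → a ≺[ M ] b → h a ≺[ M ] h b)
    monotone? h = forall-face? λ a → forall-face? λ b → (face a ⊏? face b) →-dec (face (h a) ⊏? face (h b))

  swap? : ∀ x y → Dec (Swap M x y)
  swap? x y = map′
    (λ (f , g , fg , gf , f≺ , g≺ , rest) → record
      { to = f ; from = g ; to-from = fg ; from-to = gf ; to-≺ = f≺ _ _ ; from-≺ = g≺ _ _ } , rest)
    (λ (φ , rest) → let open _≃_ φ in to , from , to-from , from-to , (λ _ _ → to-≺) , (λ _ _ → from-≺) , rest)
    (exists-fun? (λ p (g , s) → g , IsSwap-resp p (λ _ → refl) s)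
      λ f → exists-fun? (λ q s → IsSwap-resp (λ _ → refl) q s) λ g → isSwap? x y f g)

  similar? : ∀ x y → Dec (Similar M x y)
  similar? x y = (x ≟ᶠ y) ⊎-dec swap? x y

  reducibleAt? : Decidable (ReducibleAt M)
  reducibleAt? x = forall-face? λ f → facet? f →-dec ¬? (forall-face? λ y → vertex? y →-dec (similar? x y →-dec (y ≼? f)))

  abstract
    reducible? : Dec (∃ λ x → Vertex x × ReducibleAt M x)
    reducible? = exists-face? λ x → vertex? x ×-dec reducibleAt? x

-- Splitting off the sphere on a reducible class

module Splitting (M : FacePoset) (cp : IsCellularPseudomanifold M) (x₀ : Face M)
  (x : Face M) (vx : IsVertex M x) (red : ReducibleAt M x) where

  open Pseudomanifold M cp x₀
  open ReducibleClass M cp x₀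
  open Class vx red
  open Decide M cp x₀ using (similar?)

  InClass : Face M → Set
  InClass y = Vertex y × Similar M x y

  inClass? : Decidable InClass
  inClass? y = vertex? y ×-dec similar? x y

  swap-in : ∀ {c d} → InClass c → InClass d → c ≢ d → Swap M c d
  swap-in (vc , sc) (vd , sd) c≢d = swap-of c≢d (similar vc vd sc sd)

  hits : ∀ {f c d} → Facet f → InClass c → InClass d → c ≢ d → ¬ (c ≼ f) → d ≼ f
  hits fac (vc , sc) (vd , sd) = facet-hits fac vc vd sc sd

  abstract

    -- A face containing the whole class would put the class into any facet above it.
    missing : ∀ α → ∃ λ d → InClass d × ¬ (d ≼ α)
    missing α with exists-face? (λ d → inClass? d ×-dec ¬? (d ≼? α))
    ... | yes p = p
    ... | no none with facet-above α
    ... | f , fac , α≼f = ⊥-elim (red f fac λ y vy sy → ⊑-trans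
      (decidable-stable (y ≼? α) λ y⋠α → none (y , (vy , sy) , y⋠α)) α≼f)

    -- α ∖ c is the meet of α and (c d)α for a class member d outside α.
    remove : ∀ {c} → InClass c → ∀ α → ∃ λ γ →
      (∀ v → Vertex v → v ≼ γ → v ≼ α × v ≢ c) × (∀ v → Vertex v → v ≼ α → v ≢ c → v ≼ γ)
    remove {c} c∈ α with c ≼? α
    ... | no c⋠α = α , (λ v vv p → p , λ { refl → c⋠α p }) , (λ v vv p _ → p)
    ... | yes c≼α with missing α
    ... | d , d∈ , d⋠α = α ∧ φ.to α ,
        (λ v vv p → ⊑-trans p (∧-lower₁ α (φ.to α)) , λ { refl → d⋠α (φ.d⇐c (⊑-trans p (∧-lower₂ α (φ.to α)))) }) ,
        (λ v vv p v≢c → ∧-greatest p (φ.other vv v≢c (λ { refl → d⋠α p }) p))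
      where
      c≢d : c ≢ d
      c≢d refl = d⋠α c≼α
      module φ = Swapping (swap-in c∈ d∈ c≢d)

    -- α ∪ c is the join of α and c: a facet f above α omitting c contains d,
    -- so (c d)f contains both α and c.
    add : ∀ {c d} → InClass c → InClass d → c ≢ d → ∀ α → ¬ (d ≼ α) → ∃ λ γ →
      (∀ v → Vertex v → v ≼ γ → v ≼ α ⊎ v ≡ c) × α ≼ γ × c ≼ γ
    add {c} {d} c∈ d∈ c≢d α d⋠α with c ≼? α
    ... | yes c≼α = α , (λ v vv p → inj₁ p) , ⊑-refl , c≼α
    ... | no c⋠α with join (face α) (face c) | facet-avoiding d⋠α
    -- The join is not `𝟏`: a facet above `α` that omits `d` contains `c`, hence bounds the join.
    ... | 𝟏 , (_ , _ , least) | f , fac , α≼f , d⋠f = ⊥-elim (𝟏⋢ (least (face f) α≼f (hits fac d∈ c∈ (c≢d ∘ sym) d⋠f)))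
      where
      𝟏⋢ : ¬ (_≤_ M 𝟏 (face f))
      𝟏⋢ (inj₁ ())
      𝟏⋢ (inj₂ ())
    ... | face γ , (α≼γ , c≼γ , least) | _ = γ , split , α≼γ , c≼γ
      where
      module φ = Swapping (swap-in c∈ d∈ c≢d)
      split : ∀ v → Vertex v → v ≼ γ → v ≼ α ⊎ v ≡ c
      split v vv v≼γ with v ≟ᶠ c
      ... | yes v≡c = inj₂ v≡c
      ... | no v≢c = inj₁ (cofacets-⊑ (face v) (face α) below)
        where
        below : ∀ f → Facet f → α ≼ f → v ≼ f
        below f fac α≼f with c ≼? f
        ... | yes c≼f = ⊑-trans v≼γ (least (face f) α≼f c≼f)
        ... | no c⋠f with v ≟ᶠ d
        ... | yes refl = hits fac c∈ d∈ c≢d c⋠f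
        -- Being below `γ`, the vertex `v` lies in `φ.to f`; since `φ` fixes `v`, it already lies in
        -- `f`.
        ... | no v≢d = φ.other⁻¹ vv v≢c v≢d (⊑-trans v≼γ (least (face (φ.to f)) α≼φf (φ.d⇒c (hits fac c∈ d∈ c≢d c⋠f))))
          where
          α≼φf : α ≼ φ.to f
          α≼φf = shadow-≼ λ u vu u≼α → φ.other vu (λ { refl → c⋠α u≼α }) (λ { refl → d⋠α u≼α }) (⊑-trans u≼α α≼f)

    remove-all : ∀ n (c : Fin n → Face M) → (∀ i → InClass (c i)) → ∀ α → ∃ λ γ →
      (∀ v → Vertex v → v ≼ γ → v ≼ α × (∀ i → v ≢ c i)) × (∀ v → Vertex v → v ≼ α → (∀ i → v ≢ c i) → v ≼ γ)
    remove-all zero c c∈ α = α , (λ v vv p → p , λ ()) , (λ v vv p _ → p)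
    remove-all (suc n) c c∈ α with remove-all n (c ∘ suc) (c∈ ∘ suc) α
    ... | γ , down , up with remove (c∈ zero) γ
    ... | γ′ , down′ , up′ = γ′ ,
      (λ v vv p → let q , ne = down′ v vv p ; r , ne′ = down v vv q in r , λ { zero → ne ; (suc i) → ne′ i }) ,
      (λ v vv p ne → up′ v vv (up v vv p (ne ∘ suc)) (ne zero))

    -- The member `d` is held in reserve: lying outside `α` and outside `B`, it is still absent
    -- after every addition, as each call of `add` requires.
    add-all : ∀ {n} (B : Subset n) (c : Fin n → Face M) → (∀ i → InClass (c i)) →
      ∀ {d} → InClass d → (∀ i → i ∈ B → c i ≢ d) → ∀ α → ¬ (d ≼ α) → ∃ λ γ →
      (∀ v → Vertex v → v ≼ γ → v ≼ α ⊎ ∃ λ i → i ∈ B × v ≡ c i) × α ≼ γ × (∀ i → i ∈ B → c i ≼ γ)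
    add-all [] c c∈ d∈ ne α d⋠α = α , (λ v vv p → inj₁ p) , ⊑-refl , λ ()
    add-all (outside ∷ B) c c∈ d∈ ne α d⋠α with add-all B (c ∘ suc) (c∈ ∘ suc) d∈ (λ i → ne (suc i) ∘ there) α d⋠α
    ... | γ , down , α≼γ , up = γ ,
      (λ v vv p → shift (down v vv p)) , α≼γ , λ { (suc i) (there i∈B) → up i i∈B }
      where
      shift : ∀ {v} {X : Set} → X ⊎ (∃ λ i → i ∈ B × v ≡ c (suc i)) → X ⊎ (∃ λ i → i ∈ (outside ∷ B) × v ≡ c i)
      shift (inj₁ p) = inj₁ p
      shift (inj₂ (i , i∈B , e)) = inj₂ (suc i , there i∈B , e)
    add-all (inside ∷ B) c c∈ {d} d∈ ne α d⋠α with add-all B (c ∘ suc) (c∈ ∘ suc) d∈ (λ i → ne (suc i) ∘ there) α d⋠α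
    ... | γ , down , α≼γ , up with add (c∈ zero) d∈ (ne zero here) γ (λ d≼γ → d⋠γ (down d (proj₁ d∈) d≼γ))
      where
      d⋠γ : ¬ (d ≼ α ⊎ ∃ λ i → i ∈ B × d ≡ c (suc i))
      d⋠γ (inj₁ p) = d⋠α p
      d⋠γ (inj₂ (i , i∈B , e)) = ne (suc i) (there i∈B) (sym e)
    ... | γ′ , down′ , γ≼γ′ , c≼γ′ = γ′ , (λ v vv p → shift vv (down′ v vv p)) , ⊑-trans α≼γ γ≼γ′ ,
      λ { zero _ → c≼γ′ ; (suc i) (there i∈B) → ⊑-trans (up i i∈B) γ≼γ′ }
      where
      shift : ∀ {v} → Vertex v → v ≼ γ ⊎ v ≡ c zero → v ≼ α ⊎ (∃ λ i → i ∈ (inside ∷ B) × v ≡ c i)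
      shift vv (inj₂ e) = inj₂ (zero , here , e)
      shift {v} vv (inj₁ p) with down v vv p
      ... | inj₁ q = inj₁ q
      ... | inj₂ (i , i∈B , e) = inj₂ (suc i , there i∈B , e)

  module Split (m : ℕ) (c : Fin (suc m) → Face M) (c-injective : ∀ {i j} → c i ≡ c j → i ≡ j)
    (c∈ : ∀ i → InClass (c i)) (c-onto : ∀ y → InClass y → ∃ λ i → c i ≡ y) where

    Disjoint : Face M → Set
    Disjoint α = ∀ i → ¬ (c i ≼ α)

    disjoint : Enumeration Disjoint
    disjoint = enumerate finite λ α → all? λ i → ¬? (c i ≼? α)

    open Enumeration disjoint

    -- Faces are indices into `disjoint`, so no proofs of disjointness have to be compared, and the
    -- recursion meets a poset whose faces are counted already.
    Rest : FacePoset
    Rest = record { Face = Fin size ; _≺_ = λ i j → at i ≺[ M ] at j }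

    S = Sphere m

    trace : Face M → Subset (suc m)
    trace α = tabulate λ i → does (c i ≼? α)

    trace-∈ : ∀ {α i} → c i ≼ α → i ∈ trace α
    trace-∈ {α} {i} p = lookup⇒[]= i (trace α) (trans (lookup∘tabulate (λ j → does (c j ≼? α)) i) (dec-true (c i ≼? α) p))

    trace-∈⁻¹ : ∀ {α i} → i ∈ trace α → c i ≼ α
    trace-∈⁻¹ {α} {i} i∈ = of-does (c i ≼? α) (trans (sym (lookup∘tabulate (λ j → does (c j ≼? α)) i)) ([]=⇒lookup i∈))
      where
      of-does : {P : Set} (P? : Dec P) → does P? ≡ true → P
      of-does (yes p) _ = p

    trace-proper : ∀ α → T (not (full? (trace α)))
    trace-proper α with missing α
    ... | d , d∈ , d⋠α with c-onto d d∈
    ... | i , refl = proper-intro (trace α) (d⋠α ∘ trace-∈⁻¹)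

    trace-face : Face M → Face S
    trace-face α = trace α , trace-proper α

    strip : Face M → Face M
    strip α = proj₁ (remove-all (suc m) c c∈ α)

    strip-down : ∀ α {v} → Vertex v → v ≼ strip α → v ≼ α × (∀ i → v ≢ c i)
    strip-down α = proj₁ (proj₂ (remove-all (suc m) c c∈ α)) _

    strip-up : ∀ α {v} → Vertex v → v ≼ α → (∀ i → v ≢ c i) → v ≼ strip α
    strip-up α = proj₂ (proj₂ (remove-all (suc m) c c∈ α)) _

    strip-disjoint : ∀ α → Disjoint (strip α)
    strip-disjoint α i p = proj₂ (strip-down α (proj₁ (c∈ i)) p) i refl

    rest : Face M → Face Rest
    rest α = position (strip α) (strip-disjoint α)

    at-rest : ∀ α → at (rest α) ≡ strip α
    at-rest α = at-position (strip α) (strip-disjoint α)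

    abstract

      -- A proper subset `s` omits some `i`, and `c i` is the reserve member for `add-all`. Here
      -- properness of the faces of the sphere is what keeps the union a face.
      union-full : ∀ k (s : Face S) → ∃ λ γ →
        (∀ v → Vertex v → v ≼ γ → v ≼ at k ⊎ ∃ λ i → i ∈ proj₁ s × v ≡ c i) × at k ≼ γ × (∀ i → i ∈ proj₁ s → c i ≼ γ)
      union-full k (s , p) with proper-elim s p
      ... | i , i∉s = add-all s c c∈ (c∈ i) (λ j j∈s e → i∉s (subst (_∈ s) (c-injective e) j∈s)) (at k) (sound k i)

    union : Face (Rest * S) → Face M
    union (k , s) = proj₁ (union-full k s)

    union-down : ∀ k s {v} → Vertex v → v ≼ union (k , s) → v ≼ at k ⊎ ∃ λ i → i ∈ proj₁ s × v ≡ c i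
    union-down k s = proj₁ (proj₂ (union-full k s)) _

    union-rest : ∀ k s → at k ≼ union (k , s)
    union-rest k s = proj₁ (proj₂ (proj₂ (union-full k s)))

    union-sphere : ∀ k s {i} → i ∈ proj₁ s → c i ≼ union (k , s)
    union-sphere k s = proj₂ (proj₂ (proj₂ (union-full k s))) _

    to : Face M → Face (Rest * S)
    to α = rest α , trace-face α

    trace-union : ∀ k s → trace-face (union (k , s)) ≡ s
    trace-union k s = Sphere-ext m {trace-face (union (k , s))} {s} into (λ i∈s → trace-∈ (union-sphere k s i∈s))
      where
      into : trace (union (k , s)) ⊆ proj₁ s
      into {i} i∈ with union-down k s (proj₁ (c∈ i)) (trace-∈⁻¹ i∈)
      ... | inj₁ p = ⊥-elim (sound k i p)
      ... | inj₂ (j , j∈s , e) = subst (_∈ proj₁ s) (sym (c-injective e)) j∈s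

    strip-union : ∀ k s → strip (union (k , s)) ≡ at k
    strip-union k s = shadow-injective into λ v vv p → strip-up _ vv (⊑-trans p (union-rest k s)) λ { i refl → sound k i p }
      where
      into : ∀ v → Vertex v → v ≼ strip (union (k , s)) → v ≼ at k
      into v vv p with strip-down _ vv p
      ... | q , ne with union-down k s vv q
      ... | inj₁ r = r
      ... | inj₂ (i , _ , e) = ⊥-elim (ne i e)

    to-union : ∀ u → to (union u) ≡ u
    to-union (k , s) = cong₂ _,_ (injective (trans (at-rest _) (strip-union k s))) (trace-union k s)

    union-to : ∀ α → union (to α) ≡ α
    union-to α = shadow-injective into onto
      where
      into : ∀ v → Vertex v → v ≼ union (to α) → v ≼ α
      into v vv p with union-down (rest α) (trace-face α) vv p
      ... | inj₁ q = proj₁ (strip-down α vv (subst (v ≼_) (at-rest α) q))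
      ... | inj₂ (i , i∈ , refl) = trace-∈⁻¹ i∈
      onto : ∀ v → Vertex v → v ≼ α → v ≼ union (to α)
      onto v vv p with any? (λ i → v ≟ᶠ c i)
      ... | yes (i , refl) = union-sphere (rest α) (trace-face α) (trace-∈ p)
      ... | no none = ⊑-trans (subst (v ≼_) (sym (at-rest α)) (strip-up α vv p λ i e → none (i , e))) (union-rest (rest α) (trace-face α))

    Rest-≼ : ∀ {k l} → at k ≼ at l → k ≼[ Rest ] l
    Rest-≼ (inj₁ e) = inj₁ (cong face (injective (face-injective e)))
    Rest-≼ (inj₂ p) = inj₂ p

    Rest-≼⁻¹ : ∀ {k l} → k ≼[ Rest ] l → at k ≼ at l
    Rest-≼⁻¹ (inj₁ refl) = inj₁ refl
    Rest-≼⁻¹ (inj₂ p) = inj₂ p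

    to-≼ : ∀ {α β} → α ≼ β → to α ≼[ Rest * S ] to β
    to-≼ {α} {β} α≼β = *-≼ Rest S
      (Rest-≼ (subst₂ _≼_ (sym (at-rest α)) (sym (at-rest β)) (shadow-≼ λ v vv p →
        let q , ne = strip-down α vv p in strip-up β vv (⊑-trans q α≼β) ne)))
      (⊆⇒≼ m {trace-face α} {trace-face β} (λ i∈ → trace-∈ (⊑-trans (trace-∈⁻¹ i∈) α≼β)))

    union-≼ : ∀ {u w} → u ≼[ Rest * S ] w → union u ≼ union w
    union-≼ {k , s} {l , t} le = shadow-≼ below
      where
      k≼l = Rest-≼⁻¹ (proj₁ (*-≼⁻¹ Rest S le))
      s⊆t = ≼⇒⊆ m {s} {t} (proj₂ (*-≼⁻¹ Rest S le))
      below : ∀ v → Vertex v → v ≼ union (k , s) → v ≼ union (l , t)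
      below v vv p with union-down k s vv p
      ... | inj₁ q = ⊑-trans q (⊑-trans k≼l (union-rest l t))
      ... | inj₂ (i , i∈s , refl) = union-sphere l t (s⊆t i∈s)

    *-irrefl : ∀ u → ¬ (u ≺[ Rest * S ] u)
    *-irrefl (k , s) (inj₁ (_ , _ , i , i∈s , i∉s)) = i∉s i∈s
    *-irrefl (k , s) (inj₂ (p , _)) = ⊏-irrefl (face (at k)) p

    splitting : M ≃ Rest * S
    splitting = record
      { to = to ; from = union ; to-from = to-union ; from-to = union-to
      ; to-≺ = λ {α} {β} p → strict-to p (to-≼ (inj₂ p))
      ; from-≺ = λ {u} {w} p → strict-from p (union-≼ {u} {w} (inj₂ p)) }
      where
      strict-to : ∀ {α β} → α ≺[ M ] β → to α ≼[ Rest * S ] to β → to α ≺[ Rest * S ] to β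
      strict-to p (inj₂ q) = q
      strict-to {α} {β} p (inj₁ e) = ⊥-elim (⊏-irrefl (face β)
        (subst (λ γ → γ ≺[ M ] β) (trans (sym (union-to α)) (trans (cong union (face-injective e)) (union-to β))) p))
      strict-from : ∀ {u w} → u ≺[ Rest * S ] w → union u ≼ union w → union u ≺[ M ] union w
      strict-from p (inj₂ q) = q
      strict-from {u} {w} p (inj₁ e) = ⊥-elim (*-irrefl w
        (subst (λ γ → γ ≺[ Rest * S ] w) (trans (sym (to-union u)) (trans (cong to (face-injective e)) (to-union w))) p))

    -- The vertex `x` belongs to its own class and so is no face of `Rest`; the faces of `Rest`
    -- together with `x` still inject into those of `M`.
    Rest-smaller : ∀ {n} → Face M ↔ Fin n → size ℕ.< n
    Rest-smaller {n} bij = injective⇒≤ {f = f} f-injective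
      where
      open Search (n , bij) using (index; index-injective)
      f : Fin (suc size) → Fin n
      f zero = index x
      f (suc k) = index (at k)
      x≢at : ∀ k → x ≢ at k
      x≢at k e with c-onto x (vx , inj₁ refl)
      ... | i , p = sound k i (inj₁ (cong face (trans p e)))
      f-injective : ∀ {k l} → f k ≡ f l → k ≡ l
      f-injective {zero} {zero} _ = refl
      f-injective {zero} {suc l} e = ⊥-elim (x≢at l (index-injective e))
      f-injective {suc k} {zero} e = ⊥-elim (x≢at k (sym (index-injective e)))
      f-injective {suc k} {suc l} e = cong suc (injective (index-injective e))

  abstract
    split : ∃ λ k → ∃ λ m → Σ (Fin k → Fin k → Set) λ _⊰_ →
      (∀ {n} → Face M ↔ Fin n → k ℕ.< n) × M ≃ record { Face = Fin k ; _≺_ = _⊰_ } * Sphere m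
    split with enumerate finite inClass?
    -- The class contains `x`, so its size is some `suc m`, the number of points in the ground set
    -- of `Sphere m`.
    ... | record { size = zero ; position = position } with position x (vx , inj₁ refl)
    ... | ()
    split | record { size = suc m ; at = c ; injective = inj ; sound = c∈ ; position = position ; at-position = at-position } =
      _ , m , _ , Rest-smaller , splitting
      where open Split m c inj c∈ (λ y y∈ → position y y∈ , at-position y y∈)

-- Existence by iteration, and the theorem

decompose : ∀ n → Acc ℕ._<_ n → ∀ M → IsCellularPseudomanifold M → Face M → Face M ↔ Fin n →
  Σ FacePoset λ I → ∃ λ m → ∃ λ ms → IsCellularPseudomanifold I × Irreducible I × (M ≃ I * joinSpheres m ms)
decompose n (acc rs) M cp x₀ bij with Decide.reducible? M cp x₀
... | no irr = M , 0 , [] , cp , (irr ∘ Reducible⇒ReducibleAt M) , ≃-sym (*-identityʳ M)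
... | yes (x , vx , red) with Splitting.split M cp x₀ x vx red
... | k , m , _⊰_ , smaller , φ
  with decompose k (rs (smaller bij)) (record { Face = Fin k ; _≺_ = _⊰_ })
    (*-pseudomanifold⁻¹ˡ (record { Face = Fin k ; _≺_ = _⊰_ }) (Sphere m) (_≃_.to φ x₀) (≃-pseudomanifold φ x₀ cp))
    (proj₁ (_≃_.to φ x₀)) (mk↔ₛ′ id id (λ _ → refl) (λ _ → refl))
... | I , m′ , ms , cpI , irr , ψ = I , m , m′ ∷ ms , cpI , irr ,
  -- The new sphere arrives on the right of `I * joinSpheres m′ ms`; reassociating and commuting
  -- bring it to the head of the list.
  ≃-trans φ (≃-trans (*-cong ψ ≃-refl) (≃-trans (*-assoc I (joinSpheres m′ ms) (Sphere m))
    (*-cong ≃-refl (*-comm (joinSpheres m′ ms) (Sphere m)))))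

theorem5p2 : (M : FacePoset) → IsCellularPseudomanifold M → NonTrivial M →
    (Σ FacePoset λ I → Σ FacePoset λ C →
    IsCellularPseudomanifold I × IsCellularPseudomanifold C ×
    Irreducible I × CompletelyReducible C × (M ≅ I * C))
    × ((I C I′ C′ : FacePoset) →
    IsCellularPseudomanifold I → IsCellularPseudomanifold C →
    IsCellularPseudomanifold I′ → IsCellularPseudomanifold C′ →
    Irreducible I → CompletelyReducible C →
    Irreducible I′ → CompletelyReducible C′ →
    M ≅ I * C → M ≅ I′ * C′ → (I ≅ I′) × (C ≅ C′))
theorem5p2 M cp x₀ = existence , uniqueness
  where
  existence : Σ FacePoset λ I → Σ FacePoset λ C →
    IsCellularPseudomanifold I × IsCellularPseudomanifold C × Irreducible I × CompletelyReducible C × (M ≅ I * C)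
  existence with decompose _ (<-wellFounded _) M cp x₀ (proj₂ (proj₁ (proj₁ cp)))
  ... | I , m , ms , cpI , irr , φ = I , joinSpheres m ms , cpI ,
    *-pseudomanifold⁻¹ʳ I (joinSpheres m ms) (_≃_.to φ x₀) (≃-pseudomanifold φ x₀ cp) ,
    irr , (m , ms , ≃⇒≅ ≃-refl) , ≃⇒≅ φ
  uniqueness : (I C I′ C′ : FacePoset) →
    IsCellularPseudomanifold I → IsCellularPseudomanifold C → IsCellularPseudomanifold I′ → IsCellularPseudomanifold C′ →
    Irreducible I → CompletelyReducible C → Irreducible I′ → CompletelyReducible C′ →
    M ≅ I * C → M ≅ I′ * C′ → (I ≅ I′) × (C ≅ C′)
  uniqueness I C I′ C′ cpI cpC cpI′ cpC′ irrI crC irrI′ crC′ iso iso′ = ≃⇒≅ (proj₁ unique) , ≃⇒≅ (proj₂ unique)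
    where
    φ = ≅⇒≃ {M} {I * C} iso
    φ′ = ≅⇒≃ {M} {I′ * C′} iso′
    y₀ = _≃_.to φ x₀
    unique = factors-unique I C I′ C′ cpI cpC cpI′ cpC′
      irrI (CompletelyReducible⇒AllReducible C cpC (proj₂ y₀) crC)
      irrI′ (CompletelyReducible⇒AllReducible C′ cpC′ (proj₂ (_≃_.to φ′ x₀)) crC′)
      (≃-pseudomanifold φ x₀ cp) y₀ (≃-trans (≃-sym φ) φ′)
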